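{- Suppose there exist a sequence $(p_n)$ of Newman polynomials with $\deg p_n \to \infty$ and positive constants $c_0$, $\rho$ such that, for all $n$, $$ \|p_n\|_1 \ge c_0 \deg p_n \quad\text{and}\quad R(p_n) \le \rho\, \frac{1}{\deg p_n}. $$ Then for every $\rho' > \rho$ there exists an infinite sequence $(q_n)$ of Newman polynomials with $\deg q_n \to \infty$ such that $$ \|q_n\|_1 = o(\deg q_n) \ \text{ as } n \to \infty \quad\text{and}\quad R(q_n) \le \rho'\, \frac{1}{\deg q_n} \ \text{ for all } n. $$
   Context: A Newman polynomial is a polynomial in one variable all of whose coefficients are 0 or 1. For a polynomial $p(x) = \sum_{j=0}^d p_j x^j$ with $p_d \ne 0$, write $\deg p = d$, $\|p\|_\infty = \max_{0\le j\le d} |p_j|$ (the size of the maximal coefficient in absolute value), and $\|p\|_1 = \sum_{j=0}^d |p_j|$. Define $$ R(p) = \frac{\|p^2\|_\infty}{\|p\|_1^2}, $$ where $p^2$ is the square of the polynomial $p$. -}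

module Defs where

open import Data.Fin.Base using (toℕ; fromℕ<; punchIn)
open import Data.Fin.Properties using (toℕ-fromℕ; toℕ-fromℕ<; toℕ-injective; punchInᵢ≢i)
open import Data.Integer.Base as ℤ using (ℤ; +_; 0ℤ; 1ℤ; ∣_∣)
import Data.Integer.Properties as ℤ
open import Data.Nat.Base as ℕ using (ℕ; suc; NonZero; _⊔_)
import Data.Nat.Properties as ℕ
open import Data.Product.Base using (∃-syntax; _×_; _,_; proj₁; proj₂)
open import Data.Rational.Base as ℚ using (ℚ; 0ℚ; 1ℚ; _/_)
import Data.Rational.Properties as ℚ
open import Data.Rational.Solver using (module +-*-Solver)
open import Data.Sum.Base using (_⊎_; inj₁; inj₂)
open import Data.Vec.Functional as Vector using (Vector)
open import Relation.Binary.PropositionalEquality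
open import Relation.Nullary.Decidable using (yes; no)

import Algebra.Properties.CommutativeMonoid.Sum as Sum
module ℤSum = Sum ℤ.+-0-commutativeMonoid
module ℕSum = Sum ℕ.+-0-commutativeMonoid

-- ∑_{j ≤ d} p_j x^j with p_d ≠ 0. The zero polynomial, for which neither the
-- degree nor R is defined, is excluded. Integer coefficients suffice: Newman
-- polynomials and their squares have no others.
record Polynomial : Set where
  field
    degree    : ℕ
    coeff     : ℕ → ℤ
    leading≢0 : coeff degree ≢ 0ℤ
    vanishes  : ∀ {j} → degree ℕ.< j → coeff j ≡ 0ℤ

open Polynomial public

Newman : Polynomial → Set
Newman p = ∀ j → coeff p j ≡ 0ℤ ⊎ coeff p j ≡ 1ℤ

‖_‖∞ : Polynomial → ℕ
‖ p ‖∞ = Vector.foldr _⊔_ 0 {suc (degree p)} λ j → ∣ coeff p (toℕ j) ∣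

‖_‖₁ : Polynomial → ℕ
‖ p ‖₁ = ℕSum.sum {suc (degree p)} λ j → ∣ coeff p (toℕ j) ∣

infixl 7 _*ₚ_
infixr 8 _²

term : (a b : ℕ → ℤ) (k : ℕ) → Vector ℤ (suc k)
term a b k i = a (toℕ i) ℤ.* b (k ℕ.∸ toℕ i)

convolution : (ℕ → ℤ) → (ℕ → ℤ) → ℕ → ℤ
convolution a b k = ℤSum.sum (term a b k)

private
  sum-zero : ∀ {n} (t : Vector ℤ n) → (∀ i → t i ≡ 0ℤ) → ℤSum.sum t ≡ 0ℤ
  sum-zero {n} t t≡0 = trans (ℤSum.sum-cong-≗ t≡0) (ℤSum.sum-replicate-zero n)

  module _ (p q : Polynomial) where

    term-zeroʳ : ∀ k i → degree q ℕ.< k ℕ.∸ toℕ i → term (coeff p) (coeff q) k i ≡ 0ℤ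
    term-zeroʳ k i lt = trans (cong (coeff p (toℕ i) ℤ.*_) (vanishes q lt)) (ℤ.*-zeroʳ (coeff p (toℕ i)))

    term-zeroˡ : ∀ k i → degree p ℕ.< toℕ i → term (coeff p) (coeff q) k i ≡ 0ℤ
    term-zeroˡ k i lt = cong (ℤ._* coeff q (k ℕ.∸ toℕ i)) (vanishes p lt)

    product-vanishes : ∀ {k} → degree p ℕ.+ degree q ℕ.< k →
                       convolution (coeff p) (coeff q) k ≡ 0ℤ
    product-vanishes {k} d<k = sum-zero _ zeros
      where
      zeros : ∀ i → term (coeff p) (coeff q) k i ≡ 0ℤ
      zeros i with degree p ℕ.<? toℕ i
      ... | yes lt = term-zeroˡ k i lt
      ... | no ¬lt = term-zeroʳ k i (ℕ.m+n≤o⇒m≤o∸n (suc (degree q))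
              (subst (λ s → suc s ℕ.≤ k) (ℕ.+-comm (toℕ i) (degree q))
                (ℕ.≤-trans (ℕ.s≤s (ℕ.+-monoˡ-≤ (degree q) (ℕ.≮⇒≥ ¬lt))) d<k)))

    product-leading : convolution (coeff p) (coeff q) (degree p ℕ.+ degree q)
                      ≡ coeff p (degree p) ℤ.* coeff q (degree q)
    product-leading = begin
      ℤSum.sum t
        ≡⟨ ℤSum.sum-remove {i = i₀} t ⟩
      t i₀ ℤ.+ ℤSum.sum (Vector.removeAt t i₀)
        ≡⟨ cong (λ z → t i₀ ℤ.+ z) (sum-zero _ λ j → zeros (punchIn i₀ j) (punchInᵢ≢i i₀ j)) ⟩
      t i₀ ℤ.+ 0ℤ
        ≡⟨ ℤ.+-identityʳ (t i₀) ⟩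
      t i₀
        ≡⟨ cong (λ i → coeff p i ℤ.* coeff q (k ℕ.∸ i)) toℕ-i₀ ⟩
      coeff p (degree p) ℤ.* coeff q (k ℕ.∸ degree p)
        ≡⟨ cong (λ j → coeff p (degree p) ℤ.* coeff q j) (ℕ.m+n∸m≡n (degree p) (degree q)) ⟩
      coeff p (degree p) ℤ.* coeff q (degree q) ∎
      where
      open ≡-Reasoning
      k  = degree p ℕ.+ degree q
      t  = term (coeff p) (coeff q) k
      lt : degree p ℕ.< suc k
      lt = ℕ.s≤s (ℕ.m≤m+n (degree p) (degree q))
      i₀ = fromℕ< lt
      toℕ-i₀ : toℕ i₀ ≡ degree p
      toℕ-i₀ = toℕ-fromℕ< lt
      zeros : ∀ i → i ≢ i₀ → t i ≡ 0ℤ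
      zeros i i≢i₀ with degree p ℕ.<? toℕ i
      ... | yes d<i = term-zeroˡ k i d<i
      ... | no ¬d<i = term-zeroʳ k i (ℕ.m+n≤o⇒m≤o∸n (suc (degree q))
              (subst (λ s → suc s ℕ.≤ k) (ℕ.+-comm (toℕ i) (degree q))
                (ℕ.+-monoˡ-< (degree q) i<d)))
        where
        i<d : toℕ i ℕ.< degree p
        i<d = ℕ.≤∧≢⇒< (ℕ.≮⇒≥ ¬d<i) λ e → i≢i₀ (toℕ-injective (trans e (sym toℕ-i₀)))

_*ₚ_ : Polynomial → Polynomial → Polynomial
degree    (p *ₚ q) = degree p ℕ.+ degree q
coeff     (p *ₚ q) = convolution (coeff p) (coeff q)
leading≢0 (p *ₚ q) e with ℤ.i*j≡0⇒i≡0∨j≡0 (coeff p (degree p)) (trans (sym (product-leading p q)) e)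
... | inj₁ p≡0 = leading≢0 p p≡0
... | inj₂ q≡0 = leading≢0 q q≡0
vanishes  (p *ₚ q) = product-vanishes p q

_² : Polynomial → Polynomial
p ² = p *ₚ p

‖‖₁-nonZero : ∀ p → NonZero ‖ p ‖₁
‖‖₁-nonZero p = ℕ.≢-nonZero λ e → leading≢0 p (ℤ.∣i∣≡0⇒i≡0 (begin
  ∣ coeff p (degree p) ∣                ≡⟨ cong (λ j → ∣ coeff p j ∣) (toℕ-fromℕ (degree p)) ⟨
  Vector.last t                         ≡⟨ ℕ.m+n≡0⇒n≡0 (ℕSum.sum (Vector.init t))
                                             (trans (sym (ℕSum.sum-init-last t)) e) ⟩
  0                                     ∎))
  where
  open ≡-Reasoning
  t : Vector ℕ (suc (degree p))
  t j = ∣ coeff p (toℕ j) ∣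

R : Polynomial → ℚ
R p = (+ ‖ p ² ‖∞ / (‖ p ‖₁ ℕ.^ 2)) {{ℕ.m^n≢0 ‖ p ‖₁ 2 {{‖‖₁-nonZero p}}}}

-- Cauchy sequences of rationals; the sequences are not quotiented, and only
-- the order relations below are used to compare them.
record ℝ : Set where
  constructor mkℝ
  field
    seq    : ℕ → ℚ
    cauchy : ∀ ε → 0ℚ ℚ.< ε →
             ∃[ N ] ∀ m n → N ℕ.≤ m → N ℕ.≤ n → ℚ.∣ seq m ℚ.- seq n ∣ ℚ.< ε

open ℝ public

infix 4 _<ᴿ_ _≤ᴿ_
infixl 7 _*ᴿ_

_<ᴿ_ : ℝ → ℝ → Set
x <ᴿ y = ∃[ ε ] 0ℚ ℚ.< ε × (∃[ N ] ∀ n → N ℕ.≤ n → seq x n ℚ.+ ε ℚ.≤ seq y n)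

-- Equivalent to the negation of y <ᴿ x.
_≤ᴿ_ : ℝ → ℝ → Set
x ≤ᴿ y = ∀ ε → 0ℚ ℚ.< ε → ∃[ N ] ∀ n → N ℕ.≤ n → seq x n ℚ.≤ seq y n ℚ.+ ε

ℚ→ℝ : ℚ → ℝ
ℚ→ℝ q = mkℝ (λ _ → q) λ ε 0<ε → 0 , λ _ _ _ _ →
  subst (ℚ._< ε) (cong ℚ.∣_∣ (sym (ℚ.+-inverseʳ q))) 0<ε

ℕ→ℝ : ℕ → ℝ
ℕ→ℝ n = ℚ→ℝ (+ n / 1)

0ᴿ : ℝ
0ᴿ = ℚ→ℝ 0ℚ

private
  0<1 : 0ℚ ℚ.< 1ℚ
  0<1 = ℚ.positive⁻¹ 1ℚ

  split : ∀ a b → a ≡ b ℚ.+ (a ℚ.- b)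
  split = solve 2 (λ a b → a := b :+ (a :- b)) refl
    where open +-*-Solver

  factor : ∀ b c e i → b ℚ.* (e ℚ.* i) ℚ.+ (e ℚ.* i) ℚ.* c ≡ e ℚ.* (i ℚ.* (b ℚ.+ c))
  factor = solve 4 (λ b c e i → b :* (e :* i) :+ (e :* i) :* c := e :* (i :* (b :+ c))) refl
    where open +-*-Solver

  product-difference : ∀ a b c d → a ℚ.* b ℚ.- c ℚ.* d ≡ a ℚ.* (b ℚ.- d) ℚ.+ (a ℚ.- c) ℚ.* d
  product-difference = solve 4 (λ a b c d → a :* b :- c :* d := a :* (b :- d) :+ (a :- c) :* d) refl
    where open +-*-Solver

  eventually-bounded : ∀ x → ∃[ B ] 0ℚ ℚ.< B × (∃[ N ] ∀ n → N ℕ.≤ n → ℚ.∣ seq x n ∣ ℚ.≤ B)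
  eventually-bounded x with cauchy x 1ℚ 0<1
  ... | N , close = ℚ.∣ xN ∣ ℚ.+ 1ℚ , ℚ.+-mono-≤-< (ℚ.0≤∣p∣ xN) 0<1 , N , bound
    where
    xN = seq x N
    bound : ∀ n → N ℕ.≤ n → ℚ.∣ seq x n ∣ ℚ.≤ ℚ.∣ xN ∣ ℚ.+ 1ℚ
    bound n N≤n = begin
      ℚ.∣ seq x n ∣                         ≡⟨ cong ℚ.∣_∣ (split (seq x n) xN) ⟩
      ℚ.∣ xN ℚ.+ (seq x n ℚ.- xN) ∣         ≤⟨ ℚ.∣p+q∣≤∣p∣+∣q∣ xN _ ⟩
      ℚ.∣ xN ∣ ℚ.+ ℚ.∣ seq x n ℚ.- xN ∣     ≤⟨ ℚ.+-monoʳ-≤ ℚ.∣ xN ∣ (ℚ.<⇒≤ (close n N N≤n ℕ.≤-refl)) ⟩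
      ℚ.∣ xN ∣ ℚ.+ 1ℚ                       ∎
      where
      open ℚ.≤-Reasoning

  product-close : ∀ a b c d B C δ → 0ℚ ℚ.< B → 0ℚ ℚ.< C →
                  ℚ.∣ a ∣ ℚ.≤ B → ℚ.∣ d ∣ ℚ.≤ C →
                  ℚ.∣ a ℚ.- c ∣ ℚ.< δ → ℚ.∣ b ℚ.- d ∣ ℚ.< δ →
                  ℚ.∣ a ℚ.* b ℚ.- c ℚ.* d ∣ ℚ.< B ℚ.* δ ℚ.+ δ ℚ.* C
  product-close a b c d B C δ 0<B 0<C a≤B d≤C ac<δ bd<δ = begin-strict
    ℚ.∣ a ℚ.* b ℚ.- c ℚ.* d ∣
      ≡⟨ cong ℚ.∣_∣ (product-difference a b c d) ⟩
    ℚ.∣ a ℚ.* (b ℚ.- d) ℚ.+ (a ℚ.- c) ℚ.* d ∣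
      ≤⟨ ℚ.∣p+q∣≤∣p∣+∣q∣ (a ℚ.* (b ℚ.- d)) ((a ℚ.- c) ℚ.* d) ⟩
    ℚ.∣ a ℚ.* (b ℚ.- d) ∣ ℚ.+ ℚ.∣ (a ℚ.- c) ℚ.* d ∣
      ≡⟨ cong₂ ℚ._+_ (ℚ.∣p*q∣≡∣p∣*∣q∣ a (b ℚ.- d)) (ℚ.∣p*q∣≡∣p∣*∣q∣ (a ℚ.- c) d) ⟩
    ℚ.∣ a ∣ ℚ.* ℚ.∣ b ℚ.- d ∣ ℚ.+ ℚ.∣ a ℚ.- c ∣ ℚ.* ℚ.∣ d ∣
      ≤⟨ ℚ.+-mono-≤ (ℚ.*-monoʳ-≤-nonNeg ℚ.∣ b ℚ.- d ∣ {{ℚ.∣-∣-nonNeg (b ℚ.- d)}} a≤B)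
                    (ℚ.*-monoˡ-≤-nonNeg ℚ.∣ a ℚ.- c ∣ {{ℚ.∣-∣-nonNeg (a ℚ.- c)}} d≤C) ⟩
    B ℚ.* ℚ.∣ b ℚ.- d ∣ ℚ.+ ℚ.∣ a ℚ.- c ∣ ℚ.* C
      <⟨ ℚ.+-mono-< (ℚ.*-monoʳ-<-pos B {{ℚ.positive 0<B}} bd<δ)
                    (ℚ.*-monoˡ-<-pos C {{ℚ.positive 0<C}} ac<δ) ⟩
    B ℚ.* δ ℚ.+ δ ℚ.* C ∎
    where open ℚ.≤-Reasoning

  choose-δ : ∀ B C ε → 0ℚ ℚ.< B → 0ℚ ℚ.< C → 0ℚ ℚ.< ε →
             ∃[ δ ] 0ℚ ℚ.< δ × B ℚ.* δ ℚ.+ δ ℚ.* C ≡ ε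
  choose-δ B C ε 0<B 0<C 0<ε = ε ℚ.* i , 0<δ , trans (factor B C ε i)
    (trans (cong (ε ℚ.*_) (ℚ.*-inverseˡ (B ℚ.+ C))) (ℚ.*-identityʳ ε))
    where
    0<B+C : 0ℚ ℚ.< B ℚ.+ C
    0<B+C = ℚ.+-mono-< 0<B 0<C
    instance
      B+C-nonZero : ℚ.NonZero (B ℚ.+ C)
      B+C-nonZero = ℚ.>-nonZero 0<B+C
    i : ℚ
    i = ℚ.1/ (B ℚ.+ C)
    0<δ : 0ℚ ℚ.< ε ℚ.* i
    0<δ = subst (ℚ._< ε ℚ.* i) (ℚ.*-zeroˡ i)
      (ℚ.*-monoˡ-<-pos i {{ℚ.1/pos⇒pos (B ℚ.+ C) {{ℚ.positive 0<B+C}}}} 0<ε)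

  Bounded : (ℕ → ℚ) → ℚ → ℕ → Set
  Bounded a B N = ∀ n → N ℕ.≤ n → ℚ.∣ a n ∣ ℚ.≤ B

  Close : (ℕ → ℚ) → ℚ → ℕ → Set
  Close a ε N = ∀ m n → N ℕ.≤ m → N ℕ.≤ n → ℚ.∣ a m ℚ.- a n ∣ ℚ.< ε

  *-close : ∀ {a b B C δ ε N₁ N₂ N₃ N₄} → 0ℚ ℚ.< B → 0ℚ ℚ.< C →
            Bounded a B N₁ → Bounded b C N₂ → Close a δ N₃ → Close b δ N₄ →
            B ℚ.* δ ℚ.+ δ ℚ.* C ≡ ε →
            Close (λ n → a n ℚ.* b n) ε ((N₁ ⊔ N₂) ⊔ (N₃ ⊔ N₄))
  *-close {a} {b} {B} {C} {δ} {ε} {N₁} {N₂} {N₃} {N₄} 0<B 0<C a≤B b≤C ca cb eq m n N≤m N≤n =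
    subst (ℚ.∣ a m ℚ.* b m ℚ.- a n ℚ.* b n ∣ ℚ.<_) eq
      (product-close (a m) (b m) (a n) (b n) B C δ 0<B 0<C
        (a≤B m (i₁ N≤m)) (b≤C n (i₂ N≤n))
        (ca m n (i₃ N≤m) (i₃ N≤n)) (cb m n (i₄ N≤m) (i₄ N≤n)))
    where
    i₁ : ∀ {k} → (N₁ ⊔ N₂) ⊔ (N₃ ⊔ N₄) ℕ.≤ k → N₁ ℕ.≤ k
    i₁ le = ℕ.m⊔n≤o⇒m≤o N₁ N₂ (ℕ.m⊔n≤o⇒m≤o (N₁ ⊔ N₂) (N₃ ⊔ N₄) le)
    i₂ : ∀ {k} → (N₁ ⊔ N₂) ⊔ (N₃ ⊔ N₄) ℕ.≤ k → N₂ ℕ.≤ k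
    i₂ le = ℕ.m⊔n≤o⇒n≤o N₁ N₂ (ℕ.m⊔n≤o⇒m≤o (N₁ ⊔ N₂) (N₃ ⊔ N₄) le)
    i₃ : ∀ {k} → (N₁ ⊔ N₂) ⊔ (N₃ ⊔ N₄) ℕ.≤ k → N₃ ℕ.≤ k
    i₃ le = ℕ.m⊔n≤o⇒m≤o N₃ N₄ (ℕ.m⊔n≤o⇒n≤o (N₁ ⊔ N₂) (N₃ ⊔ N₄) le)
    i₄ : ∀ {k} → (N₁ ⊔ N₂) ⊔ (N₃ ⊔ N₄) ℕ.≤ k → N₄ ℕ.≤ k
    i₄ le = ℕ.m⊔n≤o⇒n≤o N₃ N₄ (ℕ.m⊔n≤o⇒n≤o (N₁ ⊔ N₂) (N₃ ⊔ N₄) le)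

  abstract
    *-cauchy : ∀ x y ε → 0ℚ ℚ.< ε → ∃[ N ] Close (λ n → seq x n ℚ.* seq y n) ε N
    *-cauchy x y ε 0<ε =
      let B , 0<B , _ , x≤B = eventually-bounded x
          C , 0<C , _ , y≤C = eventually-bounded y
          δ , 0<δ , eq      = choose-δ B C ε 0<B 0<C 0<ε
      in  _ , *-close {a = seq x} {b = seq y} 0<B 0<C x≤B y≤C
                (proj₂ (cauchy x δ 0<δ)) (proj₂ (cauchy y δ 0<δ)) eq

_*ᴿ_ : ℝ → ℝ → ℝ
x *ᴿ y = mkℝ (λ n → seq x n ℚ.* seq y n) (*-cauchy x y)

TendsToInfinity : (ℕ → ℕ) → Set
TendsToInfinity f = ∀ M → ∃[ N ] ∀ n → N ℕ.≤ n → M ℕ.≤ f n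

-- f n = o(g n), for nonnegative f and g.
LittleO : (ℕ → ℕ) → (ℕ → ℕ) → Set
LittleO f g = ∀ ε → 0ᴿ <ᴿ ε → ∃[ N ] ∀ n → N ℕ.≤ n → ℕ→ℝ (f n) ≤ᴿ ε *ᴿ ℕ→ℝ (g n)

{-# OPTIONS --safe #-}

-- One polynomial p of large degree d is enough. Fix a base t and let r be a large
-- multiple of t. The support of q consists of the numbers a + r b + r tʳ j, where a < r,
-- where j runs over the support of p, and where b < tʳ has the digit t − 1 at position a
-- in base t; so q has density about 1 / t in the blow-up of p. If x + y is given, the
-- low digits a of x and a′ of y determine each other. When a ≠ a′, the two digit
-- conditions are independent and cut the number of representations by t²; when a = a′,
-- which happens for at most two a, by t at least. Hence R(q) deg q exceeds R(p) d by a
-- factor of at most (1 + 2 t / r) (1 + 1 / d), while t may be arbitrarily large.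

module Submission where

open import Data.Bool.Base using (if_then_else_)
open import Data.Fin.Base as Fin using (Fin; toℕ; fromℕ<)
open import Data.Fin.Permutation using (reverse)
open import Data.Fin.Properties using (toℕ<n; toℕ-fromℕ<; opposite-prop)
open import Data.Integer.Base as ℤ using (+_)
import Data.Integer.Properties as ℤ
open import Data.Nat.Base renaming (_/_ to _div_)
open import Data.Nat.DivMod using (m≡m%n+[m/n]*n; m%n<n; [m+kn]%n≡m%n; m<n⇒m%n≡m; +-distrib-/-∣ʳ; m<n⇒m/n≡0; m*n/n≡m)
open import Data.Nat.Divisibility using (n∣m*n)
open import Data.Nat.Properties
open import Data.Nat.Tactic.RingSolver using (solve-∀)
open import Data.Product.Base using (Σ-syntax; ∃-syntax; _×_; _,_; proj₁; proj₂)
open import Data.Rational.Base as ℚ using (ℚ; 0ℚ; 1ℚ; _/_; ↥_; ↧ₙ_)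
import Data.Rational.Properties as ℚ
open import Data.Rational.Solver using (module +-*-Solver)
open import Data.Rational.Unnormalised.Base as ℚᵘ using (mkℚᵘ; *≡*; *≤*)
import Data.Rational.Unnormalised.Properties as ℚᵘ
open import Data.Sum.Base using (_⊎_; inj₁; inj₂)
open import Data.Vec.Functional as Vector using (Vector)
open import Defs
open import Function.Base using (_∘_; const; it)
open import Relation.Binary.PropositionalEquality
open import Relation.Nullary.Decidable using (does; yes; no; dec-true; dec-false)
open import Relation.Nullary.Negation using (contradiction)
import Algebra.Properties.Semiring.Sum +-*-semiring as ℕSemiringSum

-- Finite sums of natural numbers

abstract
  ∑ : ℕ → (ℕ → ℕ) → ℕ
  ∑ n f = ℕSum.sum {n} (f ∘ toℕ)

  ∑-def : ∀ n f → ∑ n f ≡ ℕSum.sum {n} (f ∘ toℕ)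
  ∑-def n f = refl

  ∑-empty : ∀ f → ∑ 0 f ≡ 0
  ∑-empty f = refl

  ∑-first : ∀ n f → ∑ (suc n) f ≡ f 0 + ∑ n (f ∘ suc)
  ∑-first n f = refl

  ∑-cong : ∀ n {f g} → (∀ {i} → i < n → f i ≡ g i) → ∑ n f ≡ ∑ n g
  ∑-cong n f≡g = ℕSum.sum-cong-≗ {n} λ i → f≡g (toℕ<n i)

  ∑-mono-≤ : ∀ n {f g} → (∀ {i} → i < n → f i ≤ g i) → ∑ n f ≤ ∑ n g
  ∑-mono-≤ zero    f≤g = z≤n
  ∑-mono-≤ (suc n) f≤g = +-mono-≤ (f≤g z<s) (∑-mono-≤ n (f≤g ∘ s<s))

  ∑-const : ∀ n c → ∑ n (const c) ≡ n * c
  ∑-const zero    c = refl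
  ∑-const (suc n) c = cong (_+_ c) (∑-const n c)

  ∑-zero : ∀ n {f} → (∀ {i} → i < n → f i ≡ 0) → ∑ n f ≡ 0
  ∑-zero n f≡0 = trans (∑-cong n f≡0) (trans (∑-const n 0) (*-zeroʳ n))

  ∑-distrib-+ : ∀ n f g → ∑ n (λ i → f i + g i) ≡ ∑ n f + ∑ n g
  ∑-distrib-+ n f g = ℕSum.∑-distrib-+ {n} (f ∘ toℕ) (g ∘ toℕ)

  *-distribˡ-∑ : ∀ n c f → c * ∑ n f ≡ ∑ n (λ i → c * f i)
  *-distribˡ-∑ n c f = ℕSemiringSum.*-distribˡ-sum {n} c (f ∘ toℕ)

  *-distribʳ-∑ : ∀ n c f → ∑ n f * c ≡ ∑ n (λ i → f i * c)
  *-distribʳ-∑ n c f = ℕSemiringSum.*-distribʳ-sum {n} c (f ∘ toℕ)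

  ∑-append : ∀ m n f → ∑ (m + n) f ≡ ∑ m f + ∑ n (λ i → f (m + i))
  ∑-append zero    n f = refl
  ∑-append (suc m) n f = trans (cong (_+_ (f 0)) (∑-append m n (f ∘ suc))) (sym (+-assoc (f 0) _ _))

  ∑-last : ∀ n f → ∑ (suc n) f ≡ ∑ n f + f n
  ∑-last zero    f = +-identityʳ (f 0)
  ∑-last (suc n) f = trans (cong (_+_ (f 0)) (∑-last n (f ∘ suc))) (sym (+-assoc (f 0) _ _))

  -- The indices below L m form L rows of length m; exchanging the two sums turns rows into residue
  -- classes.
  ∑-blocks : ∀ L m f → ∑ (L * m) f ≡ ∑ m λ a → ∑ L λ x → f (a + x * m)
  ∑-blocks L m f = trans (rows L f) (ℕSum.∑-comm {L} {m} λ x a → f (toℕ a + toℕ x * m))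
    where
    open ≡-Reasoning
    rows : ∀ L f → ∑ (L * m) f ≡ ∑ L λ x → ∑ m λ a → f (a + x * m)
    rows zero    f = refl
    rows (suc L) f = begin
      ∑ (m + L * m) f
        ≡⟨ ∑-append m (L * m) f ⟩
      ∑ m f + ∑ (L * m) (f ∘ (_+_ m))
        ≡⟨ cong₂ _+_ (∑-cong m λ {i} _ → cong f (sym (+-identityʳ i))) (rows L (f ∘ (_+_ m))) ⟩
      ∑ m (λ a → f (a + 0 * m)) + ∑ L (λ x → ∑ m λ a → f (m + (a + x * m)))
        ≡⟨ cong (λ z → _ + z) (∑-cong L λ {x} _ → ∑-cong m λ {a} _ → cong f (shift m a (x * m))) ⟩
      ∑ m (λ a → f (a + 0 * m)) + ∑ L (λ x → ∑ m λ a → f (a + suc x * m)) ∎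
      where
      shift : ∀ m a y → m + (a + y) ≡ a + (m + y)
      shift = solve-∀

  ∑-reverse : ∀ n f → ∑ (suc n) f ≡ ∑ (suc n) λ i → f (n ∸ i)
  ∑-reverse n f = trans (ℕSum.sum-permute {suc n} (f ∘ toℕ) reverse)
                        (ℕSum.sum-cong-≗ {suc n} λ i → cong f (opposite-prop i))

-- Cutting off by zero, instead of shortening the range, lets a sum over i ≤ n run over whole
-- blocks, as `∑-blocks` requires.
truncate : ℕ → (ℕ → ℕ) → ℕ → ℕ
truncate n f i = if does (i ≤? n) then f i else 0

truncate-≤ : ∀ {n i} f → i ≤ n → truncate n f i ≡ f i
truncate-≤ {n} {i} f i≤n rewrite dec-true (i ≤? n) i≤n = refl

truncate-> : ∀ {n i} f → n < i → truncate n f i ≡ 0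
truncate-> {n} {i} f n<i rewrite dec-false (i ≤? n) (<⇒≱ n<i) = refl

∑-truncate : ∀ {n m} f → n < m → ∑ m (truncate n f) ≡ ∑ (suc n) f
∑-truncate {n} {m} f n<m with m≤n⇒∃[o]m+o≡n n<m
... | k , refl = begin
  ∑ (suc n + k) g                                 ≡⟨ ∑-append (suc n) k g ⟩
  ∑ (suc n) g + ∑ k (λ i → g (suc n + i))         ≡⟨ cong₂ _+_
                                                      (∑-cong (suc n) λ i≤n → truncate-≤ f (s≤s⁻¹ i≤n))
                                                      (∑-zero k λ {i} _ → truncate-> f (m≤m+n (suc n) i)) ⟩
  ∑ (suc n) f + 0                                 ≡⟨ +-identityʳ _ ⟩
  ∑ (suc n) f                                     ∎
  where
  open ≡-Reasoning
  g = truncate n f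

-- The Kronecker delta and convolution

δ : ℕ → ℕ → ℕ
δ zero    zero    = 1
δ zero    (suc j) = 0
δ (suc i) zero    = 0
δ (suc i) (suc j) = δ i j

δ-refl : ∀ i → δ i i ≡ 1
δ-refl zero    = refl
δ-refl (suc i) = δ-refl i

δ-≢ : ∀ {i j} → i ≢ j → δ i j ≡ 0
δ-≢ {zero}  {zero}  i≢j = contradiction refl i≢j
δ-≢ {zero}  {suc j} i≢j = refl
δ-≢ {suc i} {zero}  i≢j = refl
δ-≢ {suc i} {suc j} i≢j = δ-≢ (i≢j ∘ cong suc)

δ≤1 : ∀ i j → δ i j ≤ 1
δ≤1 zero    zero    = ≤-refl
δ≤1 zero    (suc j) = z≤n
δ≤1 (suc i) zero    = z≤n
δ≤1 (suc i) (suc j) = δ≤1 i j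

∑-δ≤1 : ∀ n (f : ℕ → ℕ) s → (∀ {i j} → f i ≡ f j → i ≡ j) → ∑ n (λ i → δ (f i) s) ≤ 1
∑-δ≤1 zero    f s inj = ≤-trans (≤-reflexive (∑-empty _)) z≤n
∑-δ≤1 (suc n) f s inj with f 0 ≟ s
... | yes refl = ≤-reflexive (trans (∑-first n _)
                   (cong₂ _+_ (δ-refl s) (∑-zero n λ {i} _ → δ-≢ λ e → contradiction (inj {suc i} {0} e) λ ())))
... | no  f0≢s = ≤-trans
                   (≤-reflexive (trans (∑-first n _) (cong (λ z → z + ∑ n λ i → δ (f (suc i)) s) (δ-≢ f0≢s))))
                   (∑-δ≤1 n (f ∘ suc) s (suc-injective ∘ inj))

∑-δ-last : ∀ k → ∑ (suc k) (λ i → δ i k) ≡ 1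
∑-δ-last zero    = trans (∑-first 0 _) (cong (_+_ 1) (∑-empty _))
∑-δ-last (suc k) = trans (∑-first (suc k) _) (∑-δ-last k)

conv : (ℕ → ℕ) → (ℕ → ℕ) → ℕ → ℕ
conv u v n = ∑ (suc n) λ i → u i * v (n ∸ i)

conv-comm : ∀ u v n → conv u v n ≡ conv v u n
conv-comm u v n = trans (∑-reverse n λ i → u i * v (n ∸ i)) (∑-cong (suc n) λ {i} i≤n →
  trans (*-comm (u (n ∸ i)) (v (n ∸ (n ∸ i))))
        (cong (λ j → v j * u (n ∸ i)) (m∸[m∸n]≡n (s≤s⁻¹ i≤n))))

conv-monoʳ-≤ : ∀ u {v v′} → (∀ i → v i ≤ v′ i) → ∀ n → conv u v n ≤ conv u v′ n
conv-monoʳ-≤ u v≤v′ n = ∑-mono-≤ (suc n) λ {i} _ → *-monoʳ-≤ (u i) (v≤v′ (n ∸ i))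

conv-scaleˡ : ∀ c u v n → conv (λ i → c * u i) v n ≡ c * conv u v n
conv-scaleˡ c u v n = trans (∑-cong (suc n) λ {i} _ → *-assoc c (u i) (v (n ∸ i))) (sym (*-distribˡ-∑ (suc n) c λ i → u i * v (n ∸ i)))

-- Interlaced sequences and their convolutions

interlace : (m : ℕ) .{{_ : NonZero m}} → (ℕ → ℕ → ℕ) → ℕ → ℕ
interlace m w n = w (n % m) (n div m)

module _ (m : ℕ) .{{_ : NonZero m}} where

  interlace-at : ∀ w {a} x → a < m → interlace m w (a + x * m) ≡ w a x
  interlace-at w {a} x a<m = cong₂ w
    (trans ([m+kn]%n≡m%n a x m) (m<n⇒m%n≡m a<m))
    (trans (+-distrib-/-∣ʳ a (n∣m*n x)) (cong₂ _+_ (m<n⇒m/n≡0 a<m) (m*n/n≡m x m)))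

  ∑-interlace : ∀ w L → ∑ (L * m) (interlace m w) ≡ ∑ m λ a → ∑ L (w a)
  ∑-interlace w L = trans (∑-blocks L m (interlace m w))
    (∑-cong m λ a<m → ∑-cong L λ {x} _ → interlace-at w x a<m)

  -- The low digit that is added to a to produce the low digit r, with or without a carry.
  partner : ℕ → ℕ → ℕ
  partner r a = if does (a ≤? r) then r ∸ a else r + m ∸ a

  module _ {r a : ℕ} (r<m : r < m) (a<m : a < m) where

    private
      b = partner r a

    partner-spec : (a ≤ r × a + b ≡ r) ⊎ (r < a × a + b ≡ r + m)
    partner-spec with a ≤? r
    ... | yes a≤r rewrite dec-true (a ≤? r) a≤r  = inj₁ (a≤r , m+[n∸m]≡n a≤r)
    ... | no  a≰r rewrite dec-false (a ≤? r) a≰r = inj₂ (≰⇒> a≰r , m+[n∸m]≡n (≤-trans (<⇒≤ a<m) (m≤n+m m r)))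

    partner<m : b < m
    partner<m with partner-spec
    ... | inj₁ (_ , e)   = ≤-<-trans (≤-trans (m≤n+m b a) (≤-reflexive e)) r<m
    ... | inj₂ (r<a , e) = +-cancelˡ-< a b m (≤-<-trans (≤-reflexive e) (+-monoˡ-< m r<a))

    -- If a is its own partner, then a + a is r or r + m, according to the carry.
    δ-partner : δ a b ≤ δ (a + a) r + δ (a + a) (r + m)
    δ-partner with a ≟ b
    ... | no a≢b = ≤-trans (≤-reflexive (δ-≢ a≢b)) z≤n
    ... | yes a≡b with partner-spec
    ...   | inj₁ (_ , e) = ≤-trans (δ≤1 a b) (≤-trans
              (≤-reflexive (sym (trans (cong (λ j → δ (a + a) j) (sym (trans (cong (λ z → a + z) a≡b) e))) (δ-refl (a + a)))))
              (m≤m+n _ _))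
    ...   | inj₂ (_ , e) = ≤-trans (δ≤1 a b) (≤-trans
              (≤-reflexive (sym (trans (cong (λ j → δ (a + a) j) (sym (trans (cong (λ z → a + z) a≡b) e))) (δ-refl (a + a)))))
              (m≤n+m _ _))

  private
    n+n-injective : ∀ {i j} → i + i ≡ j + j → i ≡ j
    n+n-injective {i} {j} e = *-cancelˡ-≡ i j 2
      (trans (cong (_+_ i) (+-identityʳ i)) (trans e (cong (_+_ j) (sym (+-identityʳ j)))))

  -- A low digit r arises as a + a at most once without and at most once with a carry.
  ∑-δ-partner≤2 : ∀ {r} → r < m → ∑ m (λ a → δ a (partner r a)) ≤ 2
  ∑-δ-partner≤2 {r} r<m = begin
    ∑ m (λ a → δ a (partner r a))                         ≤⟨ ∑-mono-≤ m (δ-partner r<m) ⟩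
    ∑ m (λ a → δ (a + a) r + δ (a + a) (r + m))           ≡⟨ ∑-distrib-+ m (λ a → δ (a + a) r) (λ a → δ (a + a) (r + m)) ⟩
    ∑ m (λ a → δ (a + a) r) + ∑ m (λ a → δ (a + a) (r + m))
      ≤⟨ +-mono-≤ (∑-δ≤1 m (λ a → a + a) r n+n-injective)
                  (∑-δ≤1 m (λ a → a + a) (r + m) n+n-injective) ⟩
    2                                                     ∎
    where open ≤-Reasoning

  private
    diff : ∀ {n} i {j} → n ≡ i + j → n ∸ i ≡ j
    diff i refl = m+n∸m≡n i _

    regroup : ∀ a b x y → (a + b) + (x + y) * m ≡ (a + x * m) + (b + y * m)
    regroup a b x y = go a b x y m
      where
      go : ∀ a b x y m → (a + b) + (x + y) * m ≡ (a + x * m) + (b + y * m)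
      go = solve-∀

  module _ {u v : ℕ → ℕ → ℕ} {c : ℕ} {K : ℕ → ℕ → ℕ}
           (bound : ∀ {a b} → a < m → b < m → ∀ n → c * conv (u a) (v b) n ≤ K a b) where

    private
      U V : ℕ → ℕ
      U = interlace m u
      V = interlace m v

      product : ℕ → ℕ → ℕ
      product n i = U i * V (n ∸ i)

      module _ {n r} N (n≡ : n ≡ r + N * m) (r<m : r < m) where

        -- Here N′ is the quotient left after the carry, so that n minus a + x m is b + (N′ ∸ x) m.
        -- Each summand is therefore a term of `conv (u a) (v b) N′`.
        column : ∀ {a} N′ → a < m → n ≡ (a + partner r a) + N′ * m → ∀ {x} → x < suc N′ →
                 truncate n (product n) (a + x * m) ≡ u a x * v (partner r a) (N′ ∸ x)
        column {a} N′ a<m n≡′ {x} x≤N′ = begin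
          truncate n (product n) i               ≡⟨ truncate-≤ (product n) (≤-trans (m≤m+n i _) (≤-reflexive (sym n≡i+j))) ⟩
          U i * V (n ∸ i)                    ≡⟨ cong (λ j → U i * V j) (diff i n≡i+j) ⟩
          U i * V (b + (N′ ∸ x) * m)         ≡⟨ cong₂ _*_ (interlace-at u x a<m)
                                                (interlace-at v (N′ ∸ x) (partner<m r<m a<m)) ⟩
          u a x * v b (N′ ∸ x)               ∎
          where
          open ≡-Reasoning
          b = partner r a
          i = a + x * m
          n≡i+j : n ≡ i + (b + (N′ ∸ x) * m)
          n≡i+j = trans n≡′ (trans (cong (λ z → (a + b) + z * m) (sym (m+[n∸m]≡n (s≤s⁻¹ x≤N′))))
                                   (regroup a b x (N′ ∸ x)))

        last-zero : ∀ {a} → r < a → truncate n (product n) (a + N * m) ≡ 0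
        last-zero r<a = truncate-> (product n) (≤-<-trans (≤-reflexive n≡) (+-monoˡ-< (N * m) r<a))

      -- Without a carry the column is the whole convolution at N. With a carry its last index
      -- exceeds n and is cut off, which leaves the convolution at N - 1, or nothing if N = 0.
      column-bound : ∀ {n r} N {a} (n≡ : n ≡ r + N * m) (r<m : r < m) → a < m →
                     c * ∑ (suc N) (λ x → truncate n (product n) (a + x * m)) ≤ K a (partner r a)
      column-bound {n} {r} N {a} n≡ r<m a<m with partner-spec r<m a<m
      ... | inj₁ (_ , a+b≡r) = ≤-trans
              (≤-reflexive (cong (c *_) (∑-cong (suc N)
                (column N n≡ r<m N a<m (trans n≡ (cong (_+ N * m) (sym a+b≡r)))))))
              (bound a<m (partner<m r<m a<m) N)
      column-bound {n} {r} zero {a} n≡ r<m a<m | inj₂ (r<a , _) = ≤-trans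
              (≤-reflexive (trans (cong (λ z → c * z) (trans (∑-last 0 (λ x → truncate n (product n) (a + x * m)))
                (cong₂ _+_ (∑-empty (λ x → truncate n (product n) (a + x * m))) (last-zero 0 n≡ r<m r<a)))) (*-zeroʳ c)))
              z≤n
      column-bound {n} {r} (suc N) {a} n≡ r<m a<m | inj₂ (r<a , a+b≡r+m) = ≤-trans
              (≤-reflexive (cong (c *_) (trans (∑-last (suc N) (λ x → truncate n (product n) (a + x * m))) (trans
                (cong₂ _+_ (∑-cong (suc N) (column (suc N) n≡ r<m N a<m n≡′)) (last-zero (suc N) n≡ r<m r<a))
                (+-identityʳ _)))))
              (bound a<m (partner<m r<m a<m) N)
        where
        n≡′ : n ≡ (a + partner r a) + N * m
        n≡′ = trans n≡ (trans (sym (+-assoc r m _)) (cong (_+ N * m) (sym a+b≡r+m)))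

    -- As power series, the two factors are the sums of x^a u_a(x^m) and of x^b v_b(x^m) over
    -- residues a and b. For a given n each a admits a single b, and this pair contributes at most
    -- one coefficient of the product of u_a and v_b, to which `bound` applies.
    conv-interlace-≤ : ∀ n → c * conv (interlace m u) (interlace m v) n ≤ ∑ m λ a → K a (partner (n % m) a)
    conv-interlace-≤ n = begin
      c * ∑ (suc n) h
        -- The range is padded to `suc N` full blocks of length m, the fewest that contain the index
        -- n.
        ≡⟨ cong (c *_) (∑-truncate h n<) ⟨
      c * ∑ (suc N * m) (truncate n h)
        ≡⟨ cong (c *_) (∑-blocks (suc N) m (truncate n h)) ⟩
      c * ∑ m (λ a → ∑ (suc N) λ x → truncate n h (a + x * m))
        ≡⟨ *-distribˡ-∑ m c (λ a → ∑ (suc N) λ x → truncate n h (a + x * m)) ⟩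
      ∑ m (λ a → c * ∑ (suc N) λ x → truncate n h (a + x * m))
        ≤⟨ ∑-mono-≤ m (column-bound N n≡ r<m) ⟩
      ∑ m (λ a → K a (partner (n % m) a)) ∎
      where
      open ≤-Reasoning
      N   = n div m
      n≡  : n ≡ n % m + N * m
      n≡  = m≡m%n+[m/n]*n n m
      r<m = m%n<n n m
      h   = product n
      n<  : n < suc N * m
      n<  = ≤-<-trans (≤-reflexive n≡) (+-monoˡ-< (N * m) r<m)

-- Describes the coefficients of a polynomial of degree L - 1 with leading coefficient 1. Lengths,
-- unlike degrees, simply multiply under interlacing.
HasLength : (ℕ → ℕ) → ℕ → Set
HasLength u L = u (pred L) ≡ 1 × (∀ {n} → L ≤ n → u n ≡ 0)

-- The last index L m - 1 equals (m - 1) + (L - 1) m, so it carries the last term of the last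
-- residue class.
interlace-length : ∀ m .{{_ : NonZero m}} {w} L .{{_ : NonZero L}} → (∀ {a} → a < m → ∀ {x} → L ≤ x → w a x ≡ 0) →
                   w (pred m) (pred L) ≡ 1 → HasLength (interlace m w) (L * m)
interlace-length m@(suc m′) {w} L@(suc l) vanish last =
  trans (interlace-at m w l (n<1+n m′)) last ,
  λ {n} Lm≤n → vanish (m%n<n n m) (≮⇒≥ λ n/m<L → <⇒≱ (quotient< n n/m<L) Lm≤n)
  where
  quotient< : ∀ n → n div m < L → n < L * m
  quotient< n n/m<L = begin-strict
    n                       ≡⟨ m≡m%n+[m/n]*n n m ⟩
    n % m + (n div m) * m   <⟨ +-monoˡ-< _ (m%n<n n m) ⟩
    m + (n div m) * m       ≤⟨ *-monoˡ-≤ m n/m<L ⟩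
    L * m                   ∎
    where open ≤-Reasoning

-- The bound K / c on every coefficient of the product, kept free of division. Each prescribed digit
-- multiplies c by t.
record ConvBound (c : ℕ) (u v : ℕ → ℕ) (K : ℕ) : Set where
  constructor convBound
  field at : ∀ n → c * conv u v n ≤ K

open ConvBound

convBound-comm : ∀ {c u v K} → ConvBound c u v K → ConvBound c v u K
convBound-comm {c} {u} {v} {K} bound = convBound λ n →
  subst (λ z → c * z ≤ K) (conv-comm u v n) (bound .at n)

-- Prescribed digits in base t

module Digits (k : ℕ) where

  t : ℕ
  t = suc k

  -- Both insert a new lowest digit in base t. Prescribing any other digit would give the same
  -- counts, but the top digit k = t - 1 keeps the last index in the support, so that lengths are
  -- multiplied by exactly t.
  anyDigit topDigit : (ℕ → ℕ) → ℕ → ℕ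
  anyDigit u = interlace t (const u)
  topDigit u = interlace t λ i x → δ i k * u x

  free : ℕ → (ℕ → ℕ) → ℕ → ℕ
  free zero    u = u
  free (suc r) u = anyDigit (free r u)

  -- The lowest r digits in base t are free, except that digit number a must be t − 1.
  sparse : ℕ → ℕ → (ℕ → ℕ) → ℕ → ℕ
  sparse zero    a       u = u
  sparse (suc r) zero    u = topDigit (free r u)
  sparse (suc r) (suc a) u = anyDigit (sparse r a u)

  thin : (r : ℕ) .{{_ : NonZero r}} → (ℕ → ℕ) → ℕ → ℕ
  thin r u = interlace r λ a → sparse r a u

  δ*≤ : ∀ i x → δ i k * x ≤ x
  δ*≤ i x = ≤-trans (*-monoˡ-≤ x (δ≤1 i k)) (≤-reflexive (*-identityˡ x))

  sparse≤free : ∀ r a u n → sparse r a u n ≤ free r u n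
  sparse≤free zero    a       u n = ≤-refl
  sparse≤free (suc r) zero    u n = δ*≤ (n % t) _
  sparse≤free (suc r) (suc a) u n = sparse≤free r a u (n div t)

  free≤1 : ∀ r {u} → (∀ n → u n ≤ 1) → ∀ n → free r u n ≤ 1
  free≤1 zero    u≤1 n = u≤1 n
  free≤1 (suc r) u≤1 n = free≤1 r u≤1 (n div t)

  thin≤1 : ∀ r .{{_ : NonZero r}} {u} → (∀ n → u n ≤ 1) → ∀ n → thin r u n ≤ 1
  thin≤1 r {u} u≤1 n = ≤-trans (sparse≤free r (n % r) u (n div r)) (free≤1 r u≤1 (n div r))

  private
    t^-* : ∀ r x → t * (t ^ r * x) ≡ t ^ suc r * x
    t^-* r x = sym (*-assoc t (t ^ r) x)

    *-t^ : ∀ L r → L * t ^ r * t ≡ L * t ^ suc r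
    *-t^ L r = go L (t ^ r) t
      where
      go : ∀ x y z → x * y * z ≡ x * (z * y)
      go = solve-∀

  module _ {u : ℕ → ℕ} {L : ℕ} .{{_ : NonZero L}} (length : HasLength u L) where

    private
      length≢0 : ∀ r → NonZero (L * t ^ r)
      length≢0 r = m*n≢0 L (t ^ r) {{it}} {{m^n≢0 t r}}

    free-length : ∀ r → HasLength (free r u) (L * t ^ r)
    free-length zero    = subst (HasLength u) (sym (*-identityʳ L)) length
    free-length (suc r) = subst (HasLength (free (suc r) u)) (*-t^ L r)
      (interlace-length t (L * t ^ r) {{length≢0 r}} (λ _ → proj₂ (free-length r)) (proj₁ (free-length r)))

    sparse-length : ∀ r a → HasLength (sparse r a u) (L * t ^ r)
    sparse-length zero    a       = subst (HasLength u) (sym (*-identityʳ L)) length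
    sparse-length (suc r) zero    = subst (HasLength (sparse (suc r) zero u)) (*-t^ L r)
      (interlace-length t (L * t ^ r) {{length≢0 r}}
        (λ {i} _ L≤x → trans (cong (δ i k *_) (proj₂ (free-length r) L≤x)) (*-zeroʳ (δ i k)))
        (cong₂ _*_ (δ-refl k) (proj₁ (free-length r))))
    sparse-length (suc r) (suc a) = subst (HasLength (sparse (suc r) (suc a) u)) (*-t^ L r)
      (interlace-length t (L * t ^ r) {{length≢0 r}} (λ _ → proj₂ (sparse-length r a)) (proj₁ (sparse-length r a)))

    thin-length : ∀ r .{{_ : NonZero r}} → HasLength (thin r u) (L * t ^ r * r)
    thin-length r = interlace-length r (L * t ^ r) {{length≢0 r}}
      (λ {a} _ → proj₂ (sparse-length r a)) (proj₁ (sparse-length r (pred r)))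

  -- Sums of the thinned sequences

  ∑-anyDigit : ∀ u L → ∑ (L * t) (anyDigit u) ≡ t * ∑ L u
  ∑-anyDigit u L = trans (∑-interlace t _ L) (∑-const t (∑ L u))

  ∑-topDigit : ∀ u L → ∑ (L * t) (topDigit u) ≡ ∑ L u
  ∑-topDigit u L = begin
    ∑ (L * t) (topDigit u)                ≡⟨ ∑-interlace t (λ i x → δ i k * u x) L ⟩
    ∑ t (λ i → ∑ L λ x → δ i k * u x)     ≡⟨ ∑-cong t (λ {i} _ → sym (*-distribˡ-∑ L (δ i k) u)) ⟩
    ∑ t (λ i → δ i k * ∑ L u)             ≡⟨ *-distribʳ-∑ t (∑ L u) (λ i → δ i k) ⟨
    ∑ t (λ i → δ i k) * ∑ L u             ≡⟨ cong (_* ∑ L u) (∑-δ-last k) ⟩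
    1 * ∑ L u                             ≡⟨ *-identityˡ _ ⟩
    ∑ L u                                 ∎
    where open ≡-Reasoning

  module _ (u : ℕ → ℕ) (L : ℕ) where

    ∑-free : ∀ r → ∑ (L * t ^ r) (free r u) ≡ t ^ r * ∑ L u
    ∑-free zero    = trans (cong (λ M → ∑ M u) (*-identityʳ L)) (sym (*-identityˡ _))
    ∑-free (suc r) = begin
      ∑ (L * t ^ suc r) (free (suc r) u)       ≡⟨ cong (λ M → ∑ M (free (suc r) u)) (*-t^ L r) ⟨
      ∑ (L * t ^ r * t) (free (suc r) u)       ≡⟨ ∑-anyDigit (free r u) (L * t ^ r) ⟩
      t * ∑ (L * t ^ r) (free r u)             ≡⟨ cong (t *_) (∑-free r) ⟩
      t * (t ^ r * ∑ L u)                      ≡⟨ t^-* r _ ⟩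
      t ^ suc r * ∑ L u                        ∎
      where open ≡-Reasoning

    -- Of the r digits all but one are free, which leaves t^(r - 1) choices. The factor t on the
    -- left avoids the exponent r - 1.
    ∑-sparse : ∀ r a → a < r → t * ∑ (L * t ^ r) (sparse r a u) ≡ t ^ r * ∑ L u
    ∑-sparse (suc r) zero    _   = begin
      t * ∑ (L * t ^ suc r) (sparse (suc r) 0 u)   ≡⟨ cong (λ M → t * ∑ M (sparse (suc r) 0 u)) (*-t^ L r) ⟨
      t * ∑ (L * t ^ r * t) (sparse (suc r) 0 u)   ≡⟨ cong (t *_) (∑-topDigit (free r u) (L * t ^ r)) ⟩
      t * ∑ (L * t ^ r) (free r u)                 ≡⟨ cong (t *_) (∑-free r) ⟩
      t * (t ^ r * ∑ L u)                          ≡⟨ t^-* r _ ⟩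
      t ^ suc r * ∑ L u                            ∎
      where open ≡-Reasoning
    ∑-sparse (suc r) (suc a) a<r = begin
      t * ∑ (L * t ^ suc r) (sparse (suc r) (suc a) u)
        ≡⟨ cong (λ M → t * ∑ M (sparse (suc r) (suc a) u)) (*-t^ L r) ⟨
      t * ∑ (L * t ^ r * t) (sparse (suc r) (suc a) u)
        ≡⟨ cong (t *_) (∑-anyDigit (sparse r a u) (L * t ^ r)) ⟩
      t * (t * ∑ (L * t ^ r) (sparse r a u))
        ≡⟨ cong (t *_) (∑-sparse r a (s<s⁻¹ a<r)) ⟩
      t * (t ^ r * ∑ L u)
        ≡⟨ t^-* r _ ⟩
      t ^ suc r * ∑ L u ∎
      where open ≡-Reasoning

    ∑-thin : ∀ r .{{_ : NonZero r}} → t * ∑ (L * t ^ r * r) (thin r u) ≡ r * (t ^ r * ∑ L u)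
    ∑-thin r = begin
      t * ∑ (L * t ^ r * r) (thin r u)                   ≡⟨ cong (t *_) (∑-interlace r _ (L * t ^ r)) ⟩
      t * ∑ r (λ a → ∑ (L * t ^ r) (sparse r a u))       ≡⟨ *-distribˡ-∑ r t _ ⟩
      ∑ r (λ a → t * ∑ (L * t ^ r) (sparse r a u))       ≡⟨ ∑-cong r (λ {a} a<r → ∑-sparse r a a<r) ⟩
      ∑ r (const (t ^ r * ∑ L u))                        ≡⟨ ∑-const r _ ⟩
      r * (t ^ r * ∑ L u)                                ∎
      where open ≡-Reasoning

  -- Convolution bounds under digit conditions

  anyDigit-conv : ∀ {c u v K} → ConvBound c u v K → ConvBound c (anyDigit u) (anyDigit v) (t * K)
  anyDigit-conv {c} {u} {v} {K} bound = convBound λ n → ≤-trans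
    (conv-interlace-≤ t {const u} {const v} {c} {λ _ _ → K} (λ _ _ → bound .at) n)
    (≤-reflexive (∑-const t K))

  -- The lowest digit of the first summand is fixed, and then that of the second is determined by
  -- the sum: one choice remains instead of t. The saved factor is moved to the left, so that each
  -- digit contributes t on the right whether it is free or not.
  topDigit-conv : ∀ {c u v K} → ConvBound c u v K → ConvBound (t * c) (topDigit u) (anyDigit v) (t * K)
  topDigit-conv {c} {u} {v} {K} bound = convBound λ n → begin
    t * c * conv (topDigit u) (anyDigit v) n     ≡⟨ *-assoc t c _ ⟩
    t * (c * conv (topDigit u) (anyDigit v) n)   ≤⟨ *-monoʳ-≤ t (conv-interlace-≤ t
                                                    {λ i x → δ i k * u x} {const v} {c} {λ a _ → δ a k * K}
                                                    (λ {a} _ _ → digit a) n) ⟩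
    t * ∑ t (λ a → δ a k * K)                    ≡⟨ cong (t *_) (*-distribʳ-∑ t K (λ a → δ a k)) ⟨
    t * (∑ t (λ a → δ a k) * K)                  ≡⟨ cong (λ z → t * (z * K)) (∑-δ-last k) ⟩
    t * (1 * K)                                  ≡⟨ cong (t *_) (*-identityˡ K) ⟩
    t * K                                        ∎
    where
    open ≤-Reasoning
    swap : ∀ x y z → x * (y * z) ≡ y * (x * z)
    swap = solve-∀
    digit : ∀ a n → c * conv (λ x → δ a k * u x) v n ≤ δ a k * K
    digit a n = begin
      c * conv (λ x → δ a k * u x) v n   ≡⟨ cong (c *_) (conv-scaleˡ (δ a k) u v n) ⟩
      c * (δ a k * conv u v n)           ≡⟨ swap c (δ a k) _ ⟩
      δ a k * (c * conv u v n)           ≤⟨ *-monoʳ-≤ (δ a k) (bound .at n) ⟩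
      δ a k * K                          ∎

  private
    raise : ∀ r {c u v K} → ConvBound c u v (t * (t ^ r * K)) → ConvBound c u v (t ^ suc r * K)
    raise r {K = K} bound = convBound λ n → ≤-trans (bound .at n) (≤-reflexive (t^-* r K))

  free-conv : ∀ r {c u v K} → ConvBound c u v K → ConvBound c (free r u) (free r v) (t ^ r * K)
  free-conv zero    bound = convBound λ n → ≤-trans (bound .at n) (≤-reflexive (sym (*-identityˡ _)))
  free-conv (suc r) bound =
    raise r (anyDigit-conv (free-conv r bound))

  -- Each of the r digits costs a factor t on the right; position a is the only one where a factor t
  -- is saved.
  sparse-free-conv : ∀ r a {c u v K} → a < r → ConvBound c u v K →
                     ConvBound (t * c) (sparse r a u) (free r v) (t ^ r * K)
  sparse-free-conv (suc r) zero    _   bound =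
    raise r (topDigit-conv (free-conv r bound))
  sparse-free-conv (suc r) (suc a) a<r bound =
    raise r (anyDigit-conv (sparse-free-conv r a (s<s⁻¹ a<r) bound))

  -- As the positions differ, each prescribed digit faces a free one. `topDigit-conv` pays for the
  -- lower position and `sparse-free-conv` for the higher; commutativity puts the constrained
  -- sequence first where these lemmas expect it.
  sparse-conv : ∀ r a b {c u v K} → a < r → b < r → a ≢ b → ConvBound c u v K →
                ConvBound (t * (t * c)) (sparse r a u) (sparse r b v) (t ^ r * K)
  sparse-conv (suc r) zero    zero    _   _   a≢b _     = contradiction refl a≢b
  sparse-conv (suc r) zero    (suc b) _   b<r _   bound =
    raise r (topDigit-conv (convBound-comm (sparse-free-conv r b (s<s⁻¹ b<r) (convBound-comm bound))))
  sparse-conv (suc r) (suc a) zero    a<r _   _   bound =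
    raise r (convBound-comm (topDigit-conv
        (convBound-comm (sparse-free-conv r a (s<s⁻¹ a<r) bound))))
  sparse-conv (suc r) (suc a) (suc b) a<r b<r a≢b bound =
    raise r (anyDigit-conv
      (sparse-conv r a b (s<s⁻¹ a<r) (s<s⁻¹ b<r) (a≢b ∘ cong suc) bound))

  -- Two equal positions constrain a single digit only, hence the extra term.
  thin-conv : ∀ r .{{_ : NonZero r}} {u G} → (∀ n → conv u u n ≤ G) →
              ∀ n → t * t * conv (thin r u) (thin r u) n ≤ (r + 2 * t) * (t ^ r * G)
  thin-conv r {u} {G} bound n = begin
    t * t * conv (thin r u) (thin r u) n
      ≤⟨ conv-interlace-≤ r {λ a → sparse r a u} {λ a → sparse r a u} {t * t} {λ a b → X + δ a b * (t * X)} pair n ⟩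
    ∑ r (λ a → X + δ a (b a) * (t * X))
      ≡⟨ ∑-distrib-+ r (const X) (λ a → δ a (b a) * (t * X)) ⟩
    ∑ r (const X) + ∑ r (λ a → δ a (b a) * (t * X))
      ≡⟨ cong₂ _+_ (∑-const r X) (sym (*-distribʳ-∑ r (t * X) (λ a → δ a (b a)))) ⟩
    r * X + ∑ r (λ a → δ a (b a)) * (t * X)
      ≤⟨ +-monoʳ-≤ (r * X) (*-monoˡ-≤ (t * X) (∑-δ-partner≤2 r (m%n<n n r))) ⟩
    r * X + 2 * (t * X)
      ≡⟨ collect r t X ⟩
    (r + 2 * t) * X ∎
    where
    open ≤-Reasoning
    X = t ^ r * G
    b = partner r (n % r)
    collect : ∀ r t x → r * x + 2 * (t * x) ≡ (r + 2 * t) * x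
    collect = solve-∀
    bound₁ : ConvBound 1 u u G
    bound₁ = convBound λ n → ≤-trans (≤-reflexive (*-identityˡ _)) (bound n)
    pair : ∀ {a b} → a < r → b < r → ∀ n → t * t * conv (sparse r a u) (sparse r b u) n ≤ X + δ a b * (t * X)
    pair {a} {b} a<r b<r n with a ≟ b
    ... | no  a≢b = begin
      t * t * C          ≡⟨ cong (λ z → t * z * C) (*-identityʳ t) ⟨
      t * (t * 1) * C    ≤⟨ sparse-conv r a b a<r b<r a≢b bound₁ .at n ⟩
      X                  ≤⟨ m≤m+n X _ ⟩
      X + δ a b * (t * X) ∎
      where
      C = conv (sparse r a u) (sparse r b u) n
    -- Dropping the condition on the second factor by `sparse≤free` leads back to a single
    -- prescribed digit. This bounds t C by X, and one factor t is left over.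
    ... | yes refl = begin
      t * t * conv (sparse r a u) (sparse r a u) n
        ≤⟨ *-monoʳ-≤ (t * t) (conv-monoʳ-≤ (sparse r a u) (sparse≤free r a u) n) ⟩
      t * t * C
        ≡⟨ regroup t C ⟩
      t * (t * 1 * C)
        ≤⟨ *-monoʳ-≤ t (sparse-free-conv r a a<r bound₁ .at n) ⟩
      t * X
        ≡⟨ trans (cong (_* (t * X)) (δ-refl a)) (*-identityˡ (t * X)) ⟨
      δ a a * (t * X)
        ≤⟨ m≤n+m _ X ⟩
      X + δ a a * (t * X) ∎
      where
      C = conv (sparse r a u) (free r u) n
      regroup : ∀ t c → t * t * c ≡ t * (t * 1 * c)
      regroup = solve-∀

-- Newman polynomials as sequences of natural numbers

size : Polynomial → ℕ → ℕ
size p j = ℤ.∣ coeff p j ∣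

‖‖₁-∑ : ∀ p → ‖ p ‖₁ ≡ ∑ (suc (degree p)) (size p)
‖‖₁-∑ p = sym (∑-def (suc (degree p)) (size p))

private
  *-max-≤ : ∀ {n} c (f : Vector ℕ n) {B} → (∀ i → c * f i ≤ B) → c * Vector.foldr _⊔_ 0 f ≤ B
  *-max-≤ {zero}  c f f≤B = ≤-trans (≤-reflexive (*-zeroʳ c)) z≤n
  *-max-≤ {suc n} c f f≤B = ≤-trans (≤-reflexive (*-distribˡ-⊔ c (f Fin.zero) _))
    (⊔-lub (f≤B Fin.zero) (*-max-≤ c (f ∘ Fin.suc) (f≤B ∘ Fin.suc)))

  ≤-max : ∀ {n} (f : Vector ℕ n) i → f i ≤ Vector.foldr _⊔_ 0 f
  ≤-max f Fin.zero    = m≤m⊔n (f Fin.zero) _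
  ≤-max f (Fin.suc i) = ≤-trans (≤-max (f ∘ Fin.suc) i) (m≤n⊔m (f Fin.zero) _)

*-‖‖∞-≤ : ∀ p c {B} → (∀ j → c * size p j ≤ B) → c * ‖ p ‖∞ ≤ B
*-‖‖∞-≤ p c size≤B = *-max-≤ {suc (degree p)} c _ (size≤B ∘ toℕ)

size≤‖‖∞ : ∀ p j → size p j ≤ ‖ p ‖∞
size≤‖‖∞ p j with j <? suc (degree p)
... | yes j<n = subst (λ i → size p i ≤ ‖ p ‖∞) (toℕ-fromℕ< j<n)
                  (≤-max {suc (degree p)} (size p ∘ toℕ) (fromℕ< j<n))
... | no  j≮n = ≤-trans (≤-reflexive (cong ℤ.∣_∣ (vanishes p (≮⇒≥ j≮n)))) z≤n

ℤ-sum : ∀ {n} (f : Vector ℕ n) → ℤSum.sum (λ i → ℤ.+ f i) ≡ ℤ.+ ℕSum.sum f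
ℤ-sum {zero}  f = refl
ℤ-sum {suc n} f = cong (ℤ._+_ (ℤ.+ f Fin.zero)) (ℤ-sum (f ∘ Fin.suc))

convolution-conv : ∀ {a} u → (∀ j → a j ≡ ℤ.+ u j) → ∀ n → convolution a a n ≡ ℤ.+ conv u u n
convolution-conv {a} u a≡u n = begin
  ℤSum.sum (term a a n)
    ≡⟨ ℤSum.sum-cong-≗ {suc n} (λ i → trans (cong₂ ℤ._*_ (a≡u (toℕ i)) (a≡u (n ∸ toℕ i))) (sym (ℤ.pos-* (u (toℕ i)) _))) ⟩
  ℤSum.sum {suc n} (λ i → ℤ.+ (u (toℕ i) * u (n ∸ toℕ i)))
    ≡⟨ ℤ-sum {suc n} (λ i → u (toℕ i) * u (n ∸ toℕ i)) ⟩
  ℤ.+ ℕSum.sum {suc n} (λ i → u (toℕ i) * u (n ∸ toℕ i))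
    ≡⟨ cong ℤ.+_ (∑-def (suc n) λ i → u i * u (n ∸ i)) ⟨
  ℤ.+ conv u u n ∎
  where open ≡-Reasoning

module _ (p : Polynomial) (newman : Newman p) where

  newman-size : ∀ j → coeff p j ≡ ℤ.+ size p j
  newman-size j with newman j
  ... | inj₁ e = trans e (cong (ℤ.+_ ∘ ℤ.∣_∣) (sym e))
  ... | inj₂ e = trans e (cong (ℤ.+_ ∘ ℤ.∣_∣) (sym e))

  newman-size≤1 : ∀ j → size p j ≤ 1
  newman-size≤1 j with newman j
  ... | inj₁ e = ≤-trans (≤-reflexive (cong ℤ.∣_∣ e)) z≤n
  ... | inj₂ e = ≤-reflexive (cong ℤ.∣_∣ e)

  newman-length : HasLength (size p) (suc (degree p))
  newman-length = leading (newman (degree p)) , λ d<j → cong ℤ.∣_∣ (vanishes p d<j)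
    where
    leading : coeff p (degree p) ≡ ℤ.0ℤ ⊎ coeff p (degree p) ≡ ℤ.1ℤ → size p (degree p) ≡ 1
    leading (inj₁ e) with () ← leading≢0 p e
    leading (inj₂ e) = cong ℤ.∣_∣ e

  newman-size-² : ∀ n → size (p ²) n ≡ conv (size p) (size p) n
  newman-size-² n = cong ℤ.∣_∣ (convolution-conv (size p) newman-size n)

  newman-‖‖₁≤ : ‖ p ‖₁ ≤ suc (degree p)
  newman-‖‖₁≤ = begin
    ‖ p ‖₁                             ≡⟨ ‖‖₁-∑ p ⟩
    ∑ (suc (degree p)) (size p)        ≤⟨ ∑-mono-≤ (suc (degree p)) (λ {j} _ → newman-size≤1 j) ⟩
    ∑ (suc (degree p)) (const 1)       ≡⟨ trans (∑-const (suc (degree p)) 1) (*-identityʳ _) ⟩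
    suc (degree p)                     ∎
    where open ≤-Reasoning

fromSizes : ∀ (u : ℕ → ℕ) L .{{_ : NonZero L}} → HasLength u L → Polynomial
fromSizes u L (last , vanish) = record
  { degree    = pred L
  ; coeff     = ℤ.+_ ∘ u
  ; leading≢0 = λ e → contradiction (trans (sym last) (ℤ.+-injective e)) λ ()
  ; vanishes  = λ d<j → cong ℤ.+_ (vanish (subst (_≤ _) (suc-pred L) d<j))
  }

-- The thinned polynomial and its norms

module Thinning (k r : ℕ) .{{_ : NonZero r}} (p : Polynomial) (newman : Newman p) where

  open Digits k

  private
    L = suc (degree p) * t ^ r * r
    v = thin r (size p)

    instance
      t^r≢0 : NonZero (suc (degree p) * t ^ r)
      t^r≢0 = m*n≢0 (suc (degree p)) (t ^ r) {{_}} {{m^n≢0 t r}}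

      L≢0 : NonZero L
      L≢0 = m*n≢0 (suc (degree p) * t ^ r) r

  thinned : Polynomial
  thinned = fromSizes v L (thin-length (newman-length p newman) r)

  thinned-newman : Newman thinned
  thinned-newman j with v j | thin≤1 r (newman-size≤1 p newman) j
  ... | 0 | _ = inj₁ refl
  ... | 1 | _ = inj₂ refl
  ... | suc (suc _) | s≤s ()

  thinned-degree : suc (degree thinned) ≡ suc (degree p) * t ^ r * r
  thinned-degree = suc-pred L

  thinned-‖‖₁ : t * ‖ thinned ‖₁ ≡ r * (t ^ r * ‖ p ‖₁)
  thinned-‖‖₁ = begin
    t * ‖ thinned ‖₁                          ≡⟨ cong (t *_) (‖‖₁-∑ thinned) ⟩
    t * ∑ (suc (degree thinned)) v            ≡⟨ cong (λ n → t * ∑ n v) thinned-degree ⟩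
    t * ∑ L v                                 ≡⟨ ∑-thin (size p) (suc (degree p)) r ⟩
    r * (t ^ r * ∑ (suc (degree p)) (size p)) ≡⟨ cong (λ n → r * (t ^ r * n)) (‖‖₁-∑ p) ⟨
    r * (t ^ r * ‖ p ‖₁)                      ∎
    where open ≡-Reasoning

  thinned-‖²‖∞ : t * t * ‖ thinned ² ‖∞ ≤ (r + 2 * t) * (t ^ r * ‖ p ² ‖∞)
  thinned-‖²‖∞ = *-‖‖∞-≤ (thinned ²) (t * t) λ n → begin
    t * t * size (thinned ²) n   ≡⟨ cong (λ z → t * t * ℤ.∣ z ∣) (convolution-conv v (λ _ → refl) n) ⟩
    t * t * conv v v n           ≤⟨ thin-conv r conv≤ n ⟩
    (r + 2 * t) * (t ^ r * ‖ p ² ‖∞) ∎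
    where
    open ≤-Reasoning
    conv≤ : ∀ n → conv (size p) (size p) n ≤ ‖ p ² ‖∞
    conv≤ n = subst (_≤ ‖ p ² ‖∞) (newman-size-² p newman n) (size≤‖‖∞ (p ²) n)

  module _ {s} (r≡ : r ≡ s * (2 * t)) where

    private
      d = degree p
      D = degree thinned
      X = ‖ thinned ² ‖∞
      Y = ‖ thinned ‖₁
      G = ‖ p ² ‖∞
      P = ‖ p ‖₁
      T = t ^ r

    -- With denominators cleared, this is R(q) D ≤ (1 + 1 / s)² R(p) d. One factor 1 + 1 / s comes
    -- from r + 2 t = (1 + 1 / s) r, the other from d + 1 ≤ (1 + 1 / s) d. The powers of t and r
    -- cancel, because t Y = r T P exactly.
    thinned-ratio : s ≤ d → X * D * (P ^ 2) * (s * s) ≤ suc s * suc s * G * d * (Y ^ 2)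
    thinned-ratio s≤d = *-cancelˡ-≤ (t * t) {{m*n≢0 t t}} (begin
      t * t * (X * D * P ^ 2 * (s * s))
        ≡⟨ e₁ (t * t) X D P s ⟩
      (s * (t * t * X)) * (s * D) * (P * P)
        ≤⟨ *-monoˡ-≤ (P * P) (*-mono-≤ height degrees) ⟩
      (suc s * (r * T) * G) * (suc s * d * (r * T)) * (P * P)
        ≡⟨ e₂ (suc s) r T G d P ⟩
      suc s * suc s * G * d * ((r * (T * P)) * (r * (T * P)))
        ≡⟨ cong (λ z → suc s * suc s * G * d * (z * z)) thinned-‖‖₁ ⟨
      suc s * suc s * G * d * ((t * Y) * (t * Y))
        ≡⟨ e₃ (suc s * suc s * G * d) t Y ⟩
      t * t * (suc s * suc s * G * d * Y ^ 2) ∎)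
      where
      open ≤-Reasoning
      e₁ : ∀ tt X D P s → tt * (X * D * (P * (P * 1)) * (s * s)) ≡ (s * (tt * X)) * (s * D) * (P * P)
      e₁ = solve-∀
      e₂ : ∀ s′ r T G d P → (s′ * (r * T) * G) * (s′ * d * (r * T)) * (P * P)
                            ≡ s′ * s′ * G * d * ((r * (T * P)) * (r * (T * P)))
      e₂ = solve-∀
      e₃ : ∀ c t Y → c * ((t * Y) * (t * Y)) ≡ t * t * (c * (Y * (Y * 1)))
      e₃ = solve-∀
      e₄ : ∀ s t T G → s * ((s * (2 * t) + 2 * t) * (T * G)) ≡ suc s * (s * (2 * t) * T) * G
      e₄ = solve-∀
      e₅ : ∀ s d T r → s * (suc d * T * r) ≡ (s + s * d) * (r * T)
      e₅ = solve-∀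
      height : s * (t * t * X) ≤ suc s * (r * T) * G
      height = begin
        s * (t * t * X)                              ≤⟨ *-monoʳ-≤ s thinned-‖²‖∞ ⟩
        s * ((r + 2 * t) * (T * G))                  ≡⟨ cong (λ z → s * ((z + 2 * t) * (T * G))) r≡ ⟩
        s * ((s * (2 * t) + 2 * t) * (T * G))        ≡⟨ e₄ s t T G ⟩
        suc s * (s * (2 * t) * T) * G                ≡⟨ cong (λ z → suc s * (z * T) * G) r≡ ⟨
        suc s * (r * T) * G                          ∎
      degrees : s * D ≤ suc s * d * (r * T)
      degrees = begin
        s * D                      ≤⟨ *-monoʳ-≤ s (n≤1+n D) ⟩
        s * suc D                  ≡⟨ cong (s *_) thinned-degree ⟩
        s * (suc d * T * r)        ≡⟨ e₅ s d T r ⟩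
        -- Here s ≤ d absorbs the difference between the degree of p and its length d + 1.
        (s + s * d) * (r * T)      ≤⟨ *-monoˡ-≤ (r * T) (+-monoˡ-≤ (s * d) s≤d) ⟩
        suc s * d * (r * T)        ∎

  -- Since `‖ p ‖₁` is at most the length of p, its multiple in `thinned-‖‖₁` is at most the length
  -- of the blow-up; the density is thus at most 1 / t.
  thinned-‖‖₁≤ : t * ‖ thinned ‖₁ ≤ suc (degree thinned)
  thinned-‖‖₁≤ = begin
    t * ‖ thinned ‖₁                  ≡⟨ thinned-‖‖₁ ⟩
    r * (t ^ r * ‖ p ‖₁)              ≤⟨ *-monoʳ-≤ r (*-monoʳ-≤ (t ^ r) (newman-‖‖₁≤ p newman)) ⟩
    r * (t ^ r * suc (degree p))      ≡⟨ e r (t ^ r) (suc (degree p)) ⟩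
    suc (degree p) * t ^ r * r        ≡⟨ thinned-degree ⟨
    suc (degree thinned)              ∎
    where
    open ≤-Reasoning
    e : ∀ r T d → r * (T * d) ≡ d * T * r
    e = solve-∀

  -- Of the factors t^r and r of the length only r is kept. It is a multiple of t, so the degrees
  -- still diverge with t.
  thinned-degree≥ : degree p * r + r ≤ suc (degree thinned)
  thinned-degree≥ = begin
    degree p * r + r                  ≡⟨ +-comm (degree p * r) r ⟩
    suc (degree p) * r                ≤⟨ *-monoˡ-≤ r (m≤m*n (suc (degree p)) (t ^ r) {{m^n≢0 t r}}) ⟩
    suc (degree p) * t ^ r * r        ≡⟨ thinned-degree ⟨
    suc (degree thinned)              ∎
    where open ≤-Reasoning

-- Inequalities between rational numbers

ι : ℕ → ℚ
ι n = + n / 1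

private
  toℚᵘ-/ : ∀ i m → ℚ.toℚᵘ (i / suc m) ℚᵘ.≃ mkℚᵘ i m
  toℚᵘ-/ i m = ℚ.toℚᵘ-fromℚᵘ (mkℚᵘ i m)

-- Checked on unnormalised fractions, where cross-multiplication leaves an identity of integers.
/-*-cancel : ∀ i n .{{_ : NonZero n}} → (i / n) ℚ.* ι n ≡ i / 1
/-*-cancel i (suc m) = ℚ.toℚᵘ-injective (begin
  ℚ.toℚᵘ ((i / suc m) ℚ.* ι (suc m))          ≈⟨ ℚ.toℚᵘ-homo-* (i / suc m) (ι (suc m)) ⟩
  ℚ.toℚᵘ (i / suc m) ℚᵘ.* ℚ.toℚᵘ (ι (suc m))  ≈⟨ ℚᵘ.*-cong (toℚᵘ-/ i m) (toℚᵘ-/ (+ suc m) 0) ⟩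
  mkℚᵘ i m ℚᵘ.* mkℚᵘ (+ suc m) 0              ≈⟨ *≡* (lemma i (+ suc m)) ⟩
  mkℚᵘ i 0                                    ≈⟨ toℚᵘ-/ i 0 ⟨
  ℚ.toℚᵘ (i / 1)                              ∎)
  where
  open ℚᵘ.≃-Reasoning
  lemma : ∀ i n → i ℤ.* n ℤ.* + 1 ≡ i ℤ.* (n ℤ.* + 1)
  lemma i n = ℤ.*-assoc i n (+ 1)

ι-* : ∀ m n → ι (m * n) ≡ ι m ℚ.* ι n
ι-* m n = ℚ.toℚᵘ-injective (begin
  ℚ.toℚᵘ (ι (m * n))               ≈⟨ toℚᵘ-/ (+ (m * n)) 0 ⟩
  mkℚᵘ (+ (m * n)) 0               ≈⟨ *≡* (cong (ℤ._* + 1) (ℤ.pos-* m n)) ⟩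
  mkℚᵘ (+ m) 0 ℚᵘ.* mkℚᵘ (+ n) 0     ≈⟨ ℚᵘ.*-cong (toℚᵘ-/ (+ m) 0) (toℚᵘ-/ (+ n) 0) ⟨
  ℚ.toℚᵘ (ι m) ℚᵘ.* ℚ.toℚᵘ (ι n)     ≈⟨ ℚ.toℚᵘ-homo-* (ι m) (ι n) ⟨
  ℚ.toℚᵘ (ι m ℚ.* ι n)               ∎)
  where open ℚᵘ.≃-Reasoning

ι-+ : ∀ m n → ι (m + n) ≡ ι m ℚ.+ ι n
ι-+ m n = ℚ.toℚᵘ-injective (begin
  ℚ.toℚᵘ (ι (m + n))               ≈⟨ toℚᵘ-/ (+ (m + n)) 0 ⟩
  mkℚᵘ (+ (m + n)) 0               ≈⟨ *≡* (cong (ℤ._* + 1) (sym (cong₂ ℤ._+_ (ℤ.*-identityʳ (+ m)) (ℤ.*-identityʳ (+ n))))) ⟩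
  mkℚᵘ (+ m) 0 ℚᵘ.+ mkℚᵘ (+ n) 0     ≈⟨ ℚᵘ.+-cong (toℚᵘ-/ (+ m) 0) (toℚᵘ-/ (+ n) 0) ⟨
  ℚ.toℚᵘ (ι m) ℚᵘ.+ ℚ.toℚᵘ (ι n)     ≈⟨ ℚ.toℚᵘ-homo-+ (ι m) (ι n) ⟨
  ℚ.toℚᵘ (ι m ℚ.+ ι n)               ∎)
  where open ℚᵘ.≃-Reasoning

/1-mono-≤ : ∀ {i j} → i ℤ.≤ j → i / 1 ℚ.≤ j / 1
/1-mono-≤ {i} {j} i≤j = ℚ.toℚᵘ-cancel-≤ (begin
  ℚ.toℚᵘ (i / 1)   ≃⟨ toℚᵘ-/ i 0 ⟩
  mkℚᵘ i 0         ≤⟨ *≤* (ℤ.*-monoʳ-≤-nonNeg (+ 1) i≤j) ⟩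
  mkℚᵘ j 0         ≃⟨ toℚᵘ-/ j 0 ⟨
  ℚ.toℚᵘ (j / 1)   ∎)
  where open ℚᵘ.≤-Reasoning

ι-mono-≤ : ∀ {m n} → m ≤ n → ι m ℚ.≤ ι n
ι-mono-≤ m≤n = /1-mono-≤ (ℤ.+≤+ m≤n)

ι-nonNeg : ∀ n → ℚ.NonNegative (ι n)
ι-nonNeg n = ℚ.normalize-nonNeg n 1

ι-pos : ∀ n .{{_ : NonZero n}} → ℚ.Positive (ι n)
ι-pos n = ℚ.normalize-pos n 1

↥≡*↧ : ∀ x → ↥ x / 1 ≡ x ℚ.* ι (↧ₙ x)
↥≡*↧ x = trans (sym (/-*-cancel (↥ x) (↧ₙ x))) (cong (ℚ._* ι (↧ₙ x)) (ℚ.↥p/↧p≡p x))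

archimedean : ∀ x → ∃[ n ] x ℚ.≤ ι n
archimedean x@(ℚ.mkℚ i d _) = ℤ.∣ i ∣ , ℚ.toℚᵘ-cancel-≤ (begin
  mkℚᵘ i d                ≤⟨ *≤* (bound i) ⟩
  mkℚᵘ (+ ℤ.∣ i ∣) 0      ≃⟨ toℚᵘ-/ (+ ℤ.∣ i ∣) 0 ⟨
  ℚ.toℚᵘ (ι ℤ.∣ i ∣)      ∎)
  where
  open ℚᵘ.≤-Reasoning
  bound : ∀ i → i ℤ.* + 1 ℤ.≤ + ℤ.∣ i ∣ ℤ.* + suc d
  bound (+ n)      = subst₂ ℤ._≤_ (ℤ.pos-* n 1) (ℤ.pos-* n (suc d)) (ℤ.+≤+ (*-monoʳ-≤ n (s≤s z≤n)))
  bound ℤ.-[1+ n ] = ℤ.-≤+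

-- Multiplied by its denominator, a positive x becomes its numerator, which is at least 1.
archimedean⁻¹ : ∀ x → 0ℚ ℚ.< x → ∃[ n ] 1ℚ ℚ.≤ x ℚ.* ι (suc n)
archimedean⁻¹ x 0<x = ℚ.ℚ.denominator-1 x , ℚ.≤-trans (/1-mono-≤ (1≤↥ x {{ℚ.positive 0<x}})) (ℚ.≤-reflexive (↥≡*↧ x))
  where
  1≤↥ : ∀ x → {{ℚ.Positive x}} → + 1 ℤ.≤ ↥ x
  1≤↥ (ℚ.mkℚ ℤ.+[1+ n ] _ _) = ℤ.+≤+ (s≤s z≤n)

p≤∣p∣ : ∀ p → p ℚ.≤ ℚ.∣ p ∣
p≤∣p∣ p with ℚ.≤-total 0ℚ p
... | inj₁ 0≤p = ℚ.≤-reflexive (sym (ℚ.0≤p⇒∣p∣≡p 0≤p))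
... | inj₂ p≤0 = ℚ.≤-trans p≤0 (ℚ.0≤∣p∣ p)

p≤p+q : ∀ p {q} → 0ℚ ℚ.< q → p ℚ.≤ p ℚ.+ q
p≤p+q p 0<q = ℚ.≤-trans (ℚ.≤-reflexive (sym (ℚ.+-identityʳ p))) (ℚ.+-monoʳ-≤ p (ℚ.<⇒≤ 0<q))

eventually-≤ : ∀ x → ∃[ b ] ∃[ N ] ∀ n → N ≤ n → seq x n ℚ.≤ ι b
eventually-≤ x with cauchy x 1ℚ (ℚ.positive⁻¹ 1ℚ)
... | N , close with archimedean (seq x N ℚ.+ 1ℚ)
...   | b , x+1≤b = b , N , λ n N≤n → begin
  seq x n                              ≡⟨ split (seq x n) (seq x N) ⟩
  seq x N ℚ.+ (seq x n ℚ.- seq x N)    ≤⟨ ℚ.+-monoʳ-≤ (seq x N) (ℚ.≤-trans (p≤∣p∣ _)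
                                            (ℚ.<⇒≤ (close n N N≤n ≤-refl))) ⟩
  seq x N ℚ.+ 1ℚ                       ≤⟨ x+1≤b ⟩
  ι b                                  ∎
  where
  open ℚ.≤-Reasoning
  open +-*-Solver
  split : ∀ a b → a ≡ b ℚ.+ (a ℚ.- b)
  split = solve 2 (λ a b → a := b :+ (a :- b)) refl

R-‖‖₁ : ∀ p → R p ℚ.* ι (‖ p ‖₁ ^ 2) ≡ ι ‖ p ² ‖∞
R-‖‖₁ p = /-*-cancel (+ ‖ p ² ‖∞) (‖ p ‖₁ ^ 2) {{m^n≢0 ‖ p ‖₁ 2 {{‖‖₁-nonZero p}}}}

-- Both sides are multiplied by `‖ p ‖₁ ^ 2` and `‖ q ‖₁ ^ 2`, which turns each R into the height of
-- a square.
R-compare : ∀ p q a b c e →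
            ‖ q ² ‖∞ * a * ‖ p ‖₁ ^ 2 * b ≤ c * ‖ p ² ‖∞ * e * ‖ q ‖₁ ^ 2 →
            R q ℚ.* (ι a ℚ.* ι b) ℚ.≤ ι c ℚ.* R p ℚ.* ι e
R-compare p q a b c e le = ℚ.*-cancelʳ-≤-pos (ι P² ℚ.* ι Q²)
  {{ℚ.pos*pos⇒pos (ι P²) {{ι-pos P² {{norm²≢0 p}}}} (ι Q²) {{ι-pos Q² {{norm²≢0 q}}}}}} (begin
  R q ℚ.* (ι a ℚ.* ι b) ℚ.* (ι P² ℚ.* ι Q²)
    ≡⟨ solve 5 (λ r a b x y → r :* (a :* b) :* (x :* y) := r :* y :* a :* x :* b) refl (R q) (ι a) (ι b) (ι P²) (ι Q²) ⟩
  R q ℚ.* ι Q² ℚ.* ι a ℚ.* ι P² ℚ.* ι b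
    ≡⟨ cong (λ z → z ℚ.* ι a ℚ.* ι P² ℚ.* ι b) (R-‖‖₁ q) ⟩
  ι ‖ q ² ‖∞ ℚ.* ι a ℚ.* ι P² ℚ.* ι b
    ≡⟨ ι-*⁴ ‖ q ² ‖∞ a P² b ⟨
  ι (‖ q ² ‖∞ * a * P² * b)
    ≤⟨ ι-mono-≤ le ⟩
  ι (c * ‖ p ² ‖∞ * e * Q²)
    ≡⟨ ι-*⁴ c ‖ p ² ‖∞ e Q² ⟩
  ι c ℚ.* ι ‖ p ² ‖∞ ℚ.* ι e ℚ.* ι Q²
    ≡⟨ cong (λ z → ι c ℚ.* z ℚ.* ι e ℚ.* ι Q²) (R-‖‖₁ p) ⟨
  ι c ℚ.* (R p ℚ.* ι P²) ℚ.* ι e ℚ.* ι Q²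
    ≡⟨ solve 5 (λ c r x e y → c :* (r :* x) :* e :* y := c :* r :* e :* (x :* y)) refl (ι c) (R p) (ι P²) (ι e) (ι Q²) ⟩
  ι c ℚ.* R p ℚ.* ι e ℚ.* (ι P² ℚ.* ι Q²) ∎)
  where
  open ℚ.≤-Reasoning
  open +-*-Solver
  P² = ‖ p ‖₁ ^ 2
  Q² = ‖ q ‖₁ ^ 2
  norm²≢0 : ∀ p → NonZero (‖ p ‖₁ ^ 2)
  norm²≢0 p = m^n≢0 ‖ p ‖₁ 2 {{‖‖₁-nonZero p}}
  ι-*⁴ : ∀ a b c d → ι (a * b * c * d) ≡ ι a ℚ.* ι b ℚ.* ι c ℚ.* ι d
  ι-*⁴ a b c d = trans (ι-* (a * b * c) d) (cong (ℚ._* ι d)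
    (trans (ι-* (a * b) c) (cong (ℚ._* ι c) (ι-* a b))))

-- Carries an inequality of the form used in `_≤ᴿ_` from p to q with the same error ε. After
-- multiplication by D e, the main terms compare by c x ≤ e y and the error terms by c d ≤ e D. In
-- the application c / e is (1 + 1 / s)².
transfer-bound : ∀ {Q A x y ε d D c e} .{{_ : NonZero d}} .{{_ : NonZero D}} .{{_ : NonZero e}} →
                 Q ℚ.* (ι D ℚ.* ι e) ℚ.≤ ι c ℚ.* A ℚ.* ι d →
                 A ℚ.≤ x ℚ.* (+ 1 / d) ℚ.+ ε → 0ℚ ℚ.< ε →
                 ι c ℚ.* x ℚ.≤ ι e ℚ.* y → c * d ≤ e * D →
                 Q ℚ.≤ y ℚ.* (+ 1 / D) ℚ.+ ε
transfer-bound {Q} {A} {x} {y} {ε} {d} {D} {c} {e} QD≤ A≤ 0<ε cx≤ey cd≤eD =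
  ℚ.*-cancelʳ-≤-pos (ι D ℚ.* ι e) {{ℚ.pos*pos⇒pos (ι D) {{ι-pos D}} (ι e) {{ι-pos e}}}} (begin
  Q ℚ.* (ι D ℚ.* ι e)
    ≤⟨ QD≤ ⟩
  ι c ℚ.* A ℚ.* ι d
    ≤⟨ ℚ.*-monoʳ-≤-nonNeg (ι d) {{ι-nonNeg d}} (ℚ.*-monoˡ-≤-nonNeg (ι c) {{ι-nonNeg c}} A≤) ⟩
  ι c ℚ.* (x ℚ.* (+ 1 / d) ℚ.+ ε) ℚ.* ι d
    ≡⟨ solve 5 (λ c x i ε d → c :* (x :* i :+ ε) :* d := c :* x :* (i :* d) :+ c :* d :* ε) refl
         (ι c) x (+ 1 / d) ε (ι d) ⟩
  ι c ℚ.* x ℚ.* ((+ 1 / d) ℚ.* ι d) ℚ.+ ι c ℚ.* ι d ℚ.* ε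
    ≡⟨ cong₂ (λ z w → ι c ℚ.* x ℚ.* z ℚ.+ w ℚ.* ε) (/-*-cancel (+ 1) d) (sym (ι-* c d)) ⟩
  ι c ℚ.* x ℚ.* 1ℚ ℚ.+ ι (c * d) ℚ.* ε
    ≤⟨ ℚ.+-mono-≤ (ℚ.*-monoʳ-≤-nonNeg 1ℚ cx≤ey)
         (ℚ.*-monoʳ-≤-nonNeg ε {{ℚ.pos⇒nonNeg ε {{ℚ.positive 0<ε}}}} (ι-mono-≤ cd≤eD)) ⟩
  ι e ℚ.* y ℚ.* 1ℚ ℚ.+ ι (e * D) ℚ.* ε
    ≡⟨ cong₂ (λ z w → ι e ℚ.* y ℚ.* z ℚ.+ w ℚ.* ε) (/-*-cancel (+ 1) D) (sym (ι-* e D)) ⟨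
  ι e ℚ.* y ℚ.* ((+ 1 / D) ℚ.* ι D) ℚ.+ ι e ℚ.* ι D ℚ.* ε
    ≡⟨ solve 5 (λ e y i ε d → e :* y :* (i :* d) :+ e :* d :* ε := (y :* i :+ ε) :* (d :* e)) refl
         (ι e) y (+ 1 / D) ε (ι D) ⟩
  (y ℚ.* (+ 1 / D) ℚ.+ ε) ℚ.* (ι D ℚ.* ι e) ∎)
  where
  open ℚ.≤-Reasoning
  open +-*-Solver

-- The difference between (s + 1)² and s² is 2 s + 1 ≤ 3 s. Hence the excess (2 s + 1) x is at most
-- 3 s b ≤ s² / e ≤ s² ε.
absorb-factor : ∀ {x y ε b e s} .{{_ : NonZero s}} → x ℚ.≤ ι b → x ℚ.+ ε ℚ.≤ y → 1ℚ ℚ.≤ ε ℚ.* ι e → 0ℚ ℚ.< ε →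
                3 * b * e ≤ s → ι (suc s * suc s) ℚ.* x ℚ.≤ ι (s * s) ℚ.* y
absorb-factor {x} {y} {ε} {b} {e} {s} x≤b x+ε≤y 1≤εe 0<ε 3be≤s = begin
  ι (suc s * suc s) ℚ.* x
    ≡⟨ cong (λ n → ι n ℚ.* x) (square s) ⟩
  ι (s * s + w) ℚ.* x
    ≡⟨ cong (ℚ._* x) (ι-+ (s * s) w) ⟩
  (ι (s * s) ℚ.+ ι w) ℚ.* x
    ≡⟨ ℚ.*-distribʳ-+ x (ι (s * s)) (ι w) ⟩
  ι (s * s) ℚ.* x ℚ.+ ι w ℚ.* x
    ≤⟨ ℚ.+-monoʳ-≤ (ι (s * s) ℚ.* x) excess ⟩
  ι (s * s) ℚ.* x ℚ.+ ι (s * s) ℚ.* ε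
    ≡⟨ ℚ.*-distribˡ-+ (ι (s * s)) x ε ⟨
  ι (s * s) ℚ.* (x ℚ.+ ε)
    ≤⟨ ℚ.*-monoˡ-≤-nonNeg (ι (s * s)) {{ι-nonNeg (s * s)}} x+ε≤y ⟩
  ι (s * s) ℚ.* y ∎
  where
  open ℚ.≤-Reasoning
  w = 2 * s + 1
  square : ∀ s → suc s * suc s ≡ s * s + (2 * s + 1)
  square = solve-∀
  regroup : ∀ s b e → (2 * s + s) * b * e ≡ s * (3 * b * e)
  regroup = solve-∀
  wbe≤ss : w * b * e ≤ s * s
  wbe≤ss = ≤-trans (*-monoˡ-≤ e (*-monoˡ-≤ b (+-monoʳ-≤ (2 * s) (>-nonZero⁻¹ s))))
             (≤-trans (≤-reflexive (regroup s b e)) (*-monoʳ-≤ s 3be≤s))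
  excess : ι w ℚ.* x ℚ.≤ ι (s * s) ℚ.* ε
  excess = begin
    ι w ℚ.* x                          ≤⟨ ℚ.*-monoˡ-≤-nonNeg (ι w) {{ι-nonNeg w}} x≤b ⟩
    ι w ℚ.* ι b                        ≡⟨ trans (sym (ι-* w b)) (sym (ℚ.*-identityʳ _)) ⟩
    ι (w * b) ℚ.* 1ℚ                 ≤⟨ ℚ.*-monoˡ-≤-nonNeg (ι (w * b)) {{ι-nonNeg (w * b)}} 1≤εe ⟩
    ι (w * b) ℚ.* (ε ℚ.* ι e)        ≡⟨ trans (cong (ι (w * b) ℚ.*_) (ℚ.*-comm ε (ι e))) (sym (ℚ.*-assoc (ι (w * b)) (ι e) ε)) ⟩
    ι (w * b) ℚ.* ι e ℚ.* ε          ≡⟨ cong (ℚ._* ε) (ι-* (w * b) e) ⟨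
    ι (w * b * e) ℚ.* ε            ≤⟨ ℚ.*-monoʳ-≤-nonNeg ε {{ℚ.pos⇒nonNeg ε {{ℚ.positive 0<ε}}}} (ι-mono-≤ wbe≤ss) ⟩
    ι (s * s) ℚ.* ε                  ∎

-- What the limit argument uses of a thinning with r = s (2 t). The value of r turns r + 2 t into (1
-- + 1 / s) r, for every t with the same s.
record IsThinning (t s : ℕ) (p q : Polynomial) : Set where
  field
    isNewman : Newman q
    degree≥  : degree p * (s * (2 * t)) + s * (2 * t) ≤ suc (degree q)
    norm≤    : t * ‖ q ‖₁ ≤ suc (degree q)
    ratio≤   : s ≤ degree p →
               ‖ q ² ‖∞ * degree q * ‖ p ‖₁ ^ 2 * (s * s) ≤ suc s * suc s * ‖ p ² ‖∞ * degree p * ‖ q ‖₁ ^ 2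

open IsThinning

thinning : ∀ k s .{{_ : NonZero s}} p → Newman p → Σ[ q ∈ Polynomial ] IsThinning (suc k) s p q
thinning k s p newman = thinned , record
  { isNewman = thinned-newman
  ; degree≥  = thinned-degree≥
  ; norm≤    = thinned-‖‖₁≤
  ; ratio≤   = thinned-ratio {s} refl
  }
  where
  instance
    r≢0 : NonZero (s * (2 * suc k))
    r≢0 = m*n≢0 s (2 * suc k)
  open Thinning k (s * (2 * suc k)) p newman

-- The sequence of thinnings of one polynomial

module ThinSequence {s : ℕ} .{{_ : NonZero s}} {p : Polynomial} (s≤d : s ≤ degree p)
                    {q : ℕ → Polynomial} (thin : ∀ n → IsThinning (2 + n) s p (q n)) where

  private
    d = degree p

  D : ℕ → ℕ
  D n = degree (q n)

  n<D : ∀ n → n < D n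
  n<D n = s≤s⁻¹ (begin
    2 + n             ≤⟨ m≤n*m (2 + n) 2 ⟩
    2 * (2 + n)       ≤⟨ m≤n*m (2 * (2 + n)) s ⟩
    s * (2 * (2 + n))   ≤⟨ m≤n+m (s * (2 * (2 + n))) _ ⟩
    d * (s * (2 * (2 + n))) + s * (2 * (2 + n)) ≤⟨ thin n .degree≥ ⟩
    suc (D n)         ∎)
    where open ≤-Reasoning

  D≢0 : ∀ n → NonZero (D n)
  D≢0 n = >-nonZero (≤-trans (s≤s z≤n) (n<D n))

  D→∞ : TendsToInfinity D
  D→∞ M = M , λ n M≤n → ≤-trans M≤n (<⇒≤ (n<D n))

  -- As t = 2 + n is at least 2 and s at least 1, r = s (2 t) is at least 4; one of the added r pays
  -- for the 1 in D + 1.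
  4d≤D : ∀ n → d * 4 ≤ D n
  4d≤D n = s≤s⁻¹ (begin
    suc (d * 4)       ≡⟨ +-comm 1 (d * 4) ⟩
    d * 4 + 1         ≤⟨ +-mono-≤ (*-monoʳ-≤ d 4≤r) (≤-trans (s≤s z≤n) 4≤r) ⟩
    d * (s * (2 * (2 + n))) + s * (2 * (2 + n)) ≤⟨ thin n .degree≥ ⟩
    suc (D n)         ∎)
    where
    open ≤-Reasoning
    4≤r : 4 ≤ s * (2 * (2 + n))
    4≤r = ≤-trans (*-monoʳ-≤ 2 (m≤m+n 2 n)) (m≤n*m (2 * (2 + n)) s)

  -- Follows from (s + 1)² ≤ (2 s)² = 4 s² and 4 d ≤ D. This is the comparison of error terms for
  -- `transfer-bound`.
  degrees : ∀ n → suc s * suc s * d ≤ s * s * D n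
  degrees n = begin
    suc s * suc s * d        ≤⟨ *-monoˡ-≤ d (*-mono-≤ 1+s≤s+s 1+s≤s+s) ⟩
    (s + s) * (s + s) * d    ≡⟨ regroup s d ⟩
    s * s * (d * 4)          ≤⟨ *-monoʳ-≤ (s * s) (4d≤D n) ⟩
    s * s * D n              ∎
    where
    open ≤-Reasoning
    1+s≤s+s : suc s ≤ s + s
    1+s≤s+s = +-monoˡ-≤ s (>-nonZero⁻¹ s)
    regroup : ∀ s d → (s + s) * (s + s) * d ≡ s * s * (d * 4)
    regroup = solve-∀

  -- Here x and y stand for terms of the Cauchy sequences of ρ and ρ′ at a common index. The gap δ
  -- between them absorbs the factor (1 + 1 / s)².
  R-q-≤ : ∀ n {b e δ ε x y} .{{_ : NonZero d}} .{{_ : NonZero (D n)}} →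
          3 * b * e ≤ s → 0ℚ ℚ.< δ → 1ℚ ℚ.≤ δ ℚ.* ι e → 0ℚ ℚ.< ε →
          x ℚ.≤ ι b → x ℚ.+ δ ℚ.≤ y → R p ℚ.≤ x ℚ.* (+ 1 / d) ℚ.+ ε →
          R (q n) ℚ.≤ y ℚ.* (+ 1 / D n) ℚ.+ ε
  R-q-≤ n {b} {e} 3be≤s 0<δ 1≤δe 0<ε x≤b x+δ≤y Rp≤ =
    transfer-bound {d = d} {D n} {suc s * suc s} {s * s} {{it}} {{it}} {{m*n≢0 s s}}
      (R-compare p (q n) (D n) (s * s) (suc s * suc s) d (thin n .ratio≤ s≤d))
      Rp≤ 0<ε
      (absorb-factor {b = b} {e} {s} x≤b x+δ≤y 1≤δe 0<δ 3be≤s)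
      (degrees n)

  -- Eventually ε is at least η, and E is at least 1 / η. Write Y for the norm of `q n`. For n ≥ 2 E
  -- the base t = 2 + n gives 2 E Y ≤ t Y ≤ D + 1 ≤ 2 D, hence Y ≤ D / E ≤ η D. The 2 in the
  -- threshold thus makes up for the 1 in D + 1.
  sparse-q : LittleO (λ n → ‖ q n ‖₁) D
  sparse-q ε (η , 0<η , N , η≤ε) = 2 * E , λ n 2E≤n ε′ 0<ε′ → N , λ m N≤m →
    ℚ.≤-trans (bound n 2E≤n (seq ε m) (ℚ.≤-trans (ℚ.≤-reflexive (sym (ℚ.+-identityˡ η))) (η≤ε m N≤m)))
              (p≤p+q (seq ε m ℚ.* ι (D n)) 0<ε′)
    where
    E    = suc (proj₁ (archimedean⁻¹ η 0<η))
    1≤ηE = proj₂ (archimedean⁻¹ η 0<η)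

    EY≤D : ∀ n → 2 * E ≤ n → ‖ q n ‖₁ * E ≤ D n
    EY≤D n 2E≤n = *-cancelˡ-≤ 2 (begin
      2 * (Y * E)            ≡⟨ regroup Y E ⟩
      2 * E * Y              ≤⟨ *-monoˡ-≤ Y (≤-trans 2E≤n (m≤n+m n 2)) ⟩
      (2 + n) * Y            ≤⟨ thin n .norm≤ ⟩
      suc (D n)              ≤⟨ +-monoˡ-≤ (D n) (≤-trans (s≤s z≤n) (n<D n)) ⟩
      D n + D n              ≡⟨ cong (λ z → D n + z) (+-identityʳ (D n)) ⟨
      2 * D n                ∎)
      where
      open ≤-Reasoning
      Y = ‖ q n ‖₁
      regroup : ∀ Y E → 2 * (Y * E) ≡ 2 * E * Y
      regroup = solve-∀

    bound : ∀ n → 2 * E ≤ n → ∀ x → η ℚ.≤ x → ι ‖ q n ‖₁ ℚ.≤ x ℚ.* ι (D n)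
    bound n 2E≤n x η≤x = begin
      ι Y                          ≡⟨ ℚ.*-identityʳ (ι Y) ⟨
      ι Y ℚ.* 1ℚ                   ≤⟨ ℚ.*-monoˡ-≤-nonNeg (ι Y) {{ι-nonNeg Y}} 1≤ηE ⟩
      ι Y ℚ.* (η ℚ.* ι E)          ≡⟨ solve 3 (λ y h e → y :* (h :* e) := h :* (y :* e)) refl (ι Y) η (ι E) ⟩
      η ℚ.* (ι Y ℚ.* ι E)          ≡⟨ cong (λ z → η ℚ.* z) (ι-* Y E) ⟨
      η ℚ.* ι (Y * E)              ≤⟨ ℚ.*-monoˡ-≤-nonNeg η {{ℚ.pos⇒nonNeg η {{ℚ.positive 0<η}}}}
                                        (ι-mono-≤ (EY≤D n 2E≤n)) ⟩
      η ℚ.* ι (D n)                ≤⟨ ℚ.*-monoʳ-≤-nonNeg (ι (D n)) {{ι-nonNeg (D n)}} η≤x ⟩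
      x ℚ.* ι (D n)                ∎
      where
      open ℚ.≤-Reasoning
      open +-*-Solver
      Y = ‖ q n ‖₁

  ratio-limit : ∀ ρ ρ′ {δ N₁ b N₂ e} (d≢0 : NonZero d) (D≢0 : ∀ n → NonZero (D n)) →
                3 * b * e ≤ s → 0ℚ ℚ.< δ → 1ℚ ℚ.≤ δ ℚ.* ι e →
                (∀ m → N₁ ≤ m → seq ρ m ℚ.+ δ ℚ.≤ seq ρ′ m) → (∀ m → N₂ ≤ m → seq ρ m ℚ.≤ ι b) →
                ℚ→ℝ (R p) ≤ᴿ ρ *ᴿ ℚ→ℝ ((+ 1 / d) {{d≢0}}) →
                ∀ n → ℚ→ℝ (R (q n)) ≤ᴿ ρ′ *ᴿ ℚ→ℝ ((+ 1 / D n) {{D≢0 n}})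
  ratio-limit ρ ρ′ {δ} {N₁} {b} {N₂} {e} d≢0 D≢0 3be≤s 0<δ 1≤δe gap ρ≤b Rp≤ n ε 0<ε =
    -- The index m must pass three thresholds: for the gap between ρ and ρ′, for the bound b on ρ,
    -- and for the hypothesis on R p with error ε.
    let N₃ , R≤ = Rp≤ ε 0<ε in N₁ ⊔ N₂ ⊔ N₃ , λ m N≤m → let
      N₁₂≤m = m⊔n≤o⇒m≤o (N₁ ⊔ N₂) N₃ N≤m
      N₁≤m  = m⊔n≤o⇒m≤o N₁ N₂ N₁₂≤m
      N₂≤m  = m⊔n≤o⇒n≤o N₁ N₂ N₁₂≤m
      N₃≤m  = m⊔n≤o⇒n≤o (N₁ ⊔ N₂) N₃ N≤m
      in R-q-≤ n {b} {e} {δ} {ε} {seq ρ m} {seq ρ′ m} {{d≢0}} {{D≢0 n}} 3be≤s 0<δ 1≤δe 0<ε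
           (ρ≤b m N₂≤m) (gap m N₁≤m) (R≤ m N₃≤m)

sparse-sequence : ∀ p → Newman p → (deg≢0 : NonZero (degree p)) → ∀ (ρ ρ′ : ℝ) →
    ℚ→ℝ (R p) ≤ᴿ ρ *ᴿ ℚ→ℝ ((+ 1 / degree p) {{deg≢0}}) →
    ∀ {δ N₁ b N₂ e} s .{{_ : NonZero s}} → s ≤ degree p → 3 * b * e ≤ s →
    0ℚ ℚ.< δ → 1ℚ ℚ.≤ δ ℚ.* ι e →
    (∀ n → N₁ ≤ n → seq ρ n ℚ.+ δ ℚ.≤ seq ρ′ n) → (∀ n → N₂ ≤ n → seq ρ n ℚ.≤ ι b) →
    Σ[ q ∈ (ℕ → Polynomial) ]
    (∀ n → Newman (q n)) ×
    (Σ[ deg≢0′ ∈ (∀ n → NonZero (degree (q n))) ]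
    TendsToInfinity (λ n → degree (q n)) ×
    LittleO (λ n → ‖ q n ‖₁) (λ n → degree (q n)) ×
    (∀ n → ℚ→ℝ (R (q n)) ≤ᴿ ρ′ *ᴿ ℚ→ℝ ((+ 1 / degree (q n)) {{deg≢0′ n}})))
sparse-sequence p newman deg≢0 ρ ρ′ Rp≤ {b = b} {e = e} s s≤d 3be≤s 0<δ 1≤δe gap ρ≤b =
  proj₁ ∘ q , isNewman ∘ thin , D≢0 , D→∞ , sparse-q ,
  ratio-limit ρ ρ′ {b = b} {e = e} deg≢0 D≢0 3be≤s 0<δ 1≤δe gap ρ≤b Rp≤
  where
  q : ∀ n → Σ[ q ∈ Polynomial ] IsThinning (2 + n) s p q
  -- The base is t = 2 + n, while `thinning` takes t - 1.
  q n = thinning (suc n) s p newman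

  thin : ∀ n → IsThinning (2 + n) s p (proj₁ (q n))
  thin n = proj₂ (q n)

  open ThinSequence s≤d thin

theorem1 : (p : ℕ → Polynomial) →
    (∀ n → Newman (p n)) →
    (deg≢0 : ∀ n → NonZero (degree (p n))) →
    TendsToInfinity (λ n → degree (p n)) →
    (c₀ ρ : ℝ) → 0ᴿ <ᴿ c₀ → 0ᴿ <ᴿ ρ →
    (∀ n → c₀ *ᴿ ℕ→ℝ (degree (p n)) ≤ᴿ ℕ→ℝ ‖ p n ‖₁ ×
    ℚ→ℝ (R (p n)) ≤ᴿ ρ *ᴿ ℚ→ℝ ((+ 1 / degree (p n)) {{deg≢0 n}})) →
    (ρ′ : ℝ) → ρ <ᴿ ρ′ →
    Σ[ q ∈ (ℕ → Polynomial) ]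
    (∀ n → Newman (q n)) ×
    (Σ[ deg≢0′ ∈ (∀ n → NonZero (degree (q n))) ]
    TendsToInfinity (λ n → degree (q n)) ×
    LittleO (λ n → ‖ q n ‖₁) (λ n → degree (q n)) ×
    (∀ n → ℚ→ℝ (R (q n)) ≤ᴿ ρ′ *ᴿ ℚ→ℝ ((+ 1 / degree (q n)) {{deg≢0′ n}})))
theorem1 p newman deg≢0 deg→∞ c₀ ρ _ _ bounds ρ′ (δ , 0<δ , _ , gap) =
  let b , _ , ρ≤b = eventually-≤ ρ
      e , 1≤δe    = archimedean⁻¹ δ 0<δ
      -- Here ρ is eventually at most b and 1 / (e + 1) at most δ, so this s makes the loss (1 + 1 /
      -- s)² fit between ρ and ρ′. The outer `suc` makes s nonzero. A member of the given sequence
      -- of degree at least s is then chosen.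
      s           = suc (3 * b * suc e)
      i , s≤deg   = deg→∞ s
  in  sparse-sequence (p i) (newman i) (deg≢0 i) ρ ρ′ (proj₂ (bounds i))
        {b = b} {e = suc e} s (s≤deg i ≤-refl) (n≤1+n _) 0<δ 1≤δe gap ρ≤b
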